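{- Let $X$ be a finite set with similarity function $S$, suppose the target clustering $\mathcal{C}^{\ast}=\{C^{\ast}_1,\dots,C^{\ast}_k\}$ satisfies stability with respect to $S$, and suppose the initial clustering has overclustering error $\delta_o$ and underclustering error $\delta_u$. In the unrestricted-merge model with uniformly random merge requests, for every $\epsilon\in(0,1)$, with probability at least $1-\epsilon$ the interactive algorithm using the global split procedure and the unrestricted merge procedure (described below) requires at most $\delta_o$ split requests and $O(\log\frac{k}{\epsilon}\,\delta_u^2)$ merge requests to find the target clustering.
   Context: For nonempty $A,A'\subseteq X$, $S(A,A')$ is the average of $S(x,y)$ over $x\in A,y\in A'$. $\mathcal{C}^{\ast}$ satisfies stability w.r.t. $S$ if for all $i\neq j$, every nonempty proper $A\subset C^{\ast}_i$ and nonempty $A'\subseteq C^{\ast}_j$: $S(A,C^{\ast}_i\setminus A)>S(A,A')$. For clusterings $\mathcal{C},\mathcal{C}'$, $\mathrm{dist}(\mathcal{C},\mathcal{C}')=\sum_{A\in\mathcal{C}}(|\{B\in\mathcal{C}':B\cap A\neq\emptyset\}|-1)$; for the initial clustering $\mathcal{C}$, $\delta_u=\mathrm{dist}(\mathcal{C}^{\ast},\mathcal{C})$ and $\delta_o=\mathrm{dist}(\mathcal{C},\mathcal{C}^{\ast})$. Average-linkage tree $T_{glob}$: leaves are singletons; repeatedly merge the two current nodes $N_1,N_2$ with largest $S(N_1,N_2)$ (ties arbitrary) into parent $N_1\cup N_2$ until the root $X$ remains. Split$(Y)$ for $Y\subseteq X$ with $|Y|\ge2$: let $N$ be the deepest node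 of $T_{glob}$ containing $Y$, with children $N_1,N_2$; output $Y\cap N_1$, $Y\cap N_2$. Process (unrestricted-merge model): starting from the initial clustering, an oracle repeatedly issues either split$(C_i)$, allowed only if current cluster $C_i$ contains points of two or more target clusters (which split is requested, and when splits vs merges are requested, is arbitrary), or merge$(C_i,C_j)$ for distinct current clusters, allowed only if some target cluster meets both $C_i$ and $C_j$. Each time a merge request is issued, the pair is chosen uniformly at random among all currently allowed merge pairs. Split procedure: replace $C_i$ by the two sets output by Split$(C_i)$. Unrestricted merge procedure: let $C'_i,C'_j$ be the output of Split$(C_i\cup C_j)$; delete $C_i,C_j$; if $\{C'_i,C'_j\}=\{C_i,C_j\}$ add the single cluster $C_i\cup C_j$, otherwise add $C'_i$ and $C'_j$. The $O(\cdot)$ hides an absolute constant; counts are of requests until the current clustering equals $\mathcal{C}^{\ast}$.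
   Formalization: The logarithm in the merge bound is read as log₂ max(2, k/ε); this matters only for k = 1 and ε > 1/2, where log(k/ε) tends to 0 as ε → 1 although one merge may be unavoidable, so the literal bound fails. -}

module Defs where

open import Algebra.Bundles using (CommutativeRing; Semiring)
open import Algebra.Core using (Op₁; Op₂)
open import Algebra.Structures using (IsCommutativeRing)
import Algebra.Definitions.RawSemiring as RawSemiringDefinitions
open import Data.Bool.Properties using () renaming (_≟_ to _≟ᵇ_)
open import Data.Fin using (Fin)
open import Data.Fin.Subset using (Subset; _∈_; _⊆_; _⊂_; _∩_; _∪_; _─_; ∣_∣; ⁅_⁆; Nonempty)
open import Data.Fin.Subset.Properties using (_∈?_; _⊆?_; nonempty?)
open import Data.List using (List; []; _∷_; _++_; [_]; map; filter; length; foldr; concatMap; allFin; lookup)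
import Data.List.Membership.DecPropositional as DecMembership
open import Data.List.Membership.Propositional using () renaming (_∈_ to _∈ˡ_)
open import Data.List.Relation.Binary.Permutation.Propositional using (_↭_)
open import Data.List.Relation.Unary.All using (All; all?)
open import Data.List.Relation.Unary.AllPairs using (AllPairs)
open import Data.List.Relation.Unary.Any using (Any; any?)
open import Data.Nat as ℕ using (ℕ; zero; suc; _∸_)
open import Data.Nat.ListAction using (sum)
open import Data.Product using (∃; ∃-syntax; _×_; _,_; proj₁; proj₂; map₂)
open import Data.Sum using (_⊎_)
open import Data.Vec.Properties using (≡-dec)
open import Level using (Level; _⊔_) renaming (suc to lsuc)
open import Relation.Binary.Construct.Closure.ReflexiveTransitive using (Star)
open import Relation.Binary.Core using (Rel)
open import Relation.Binary.Definitions using (DecidableEquality)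
open import Relation.Binary.PropositionalEquality using (_≡_; _≢_)
open import Relation.Binary.Structures using (IsDecTotalOrder)
open import Relation.Nullary using (¬_; Dec; yes; no)
open import Relation.Nullary.Decidable using (¬?; _×-dec_; _⊎-dec_)
open import Relation.Unary using (Pred; Decidable)

-- Stands in for ℝ, which the library lacks; classically, ℝ is an instance.
record ArchimedeanOrderedField (a ℓ₁ ℓ₂ : Level) : Set (lsuc (a ⊔ ℓ₁ ⊔ ℓ₂)) where
  infix  8 _⁻¹
  infixl 7 _*_ _/_
  infixl 6 _+_ _-_
  infix  4 _≈_ _≤_ _<_
  field
    Carrier           : Set a
    _≈_               : Rel Carrier ℓ₁
    _≤_               : Rel Carrier ℓ₂
    _+_ _*_           : Op₂ Carrier
    -_                : Op₁ Carrier
    0# 1#             : Carrier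
    isCommutativeRing : IsCommutativeRing _≈_ _+_ _*_ -_ 0# 1#
    isDecTotalOrder   : IsDecTotalOrder _≈_ _≤_
    0≉1               : ¬ (0# ≈ 1#)
    -- total; the value at 0# is unspecified
    _⁻¹               : Op₁ Carrier
    ⁻¹-cong           : ∀ {x y} → x ≈ y → x ⁻¹ ≈ y ⁻¹
    *-inverseʳ        : ∀ x → ¬ (x ≈ 0#) → x * x ⁻¹ ≈ 1#
    +-monoˡ-≤         : ∀ z {x y} → x ≤ y → x + z ≤ y + z
    *-nonNeg          : ∀ {x y} → 0# ≤ x → 0# ≤ y → 0# ≤ x * y

  commutativeRing : CommutativeRing a ℓ₁
  commutativeRing = record { isCommutativeRing = isCommutativeRing }

  open RawSemiringDefinitions (Semiring.rawSemiring (CommutativeRing.semiring commutativeRing)) public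
    using (_^_) renaming (_×_ to _·_)
  open IsDecTotalOrder isDecTotalOrder public using (_≤?_)

  _<_ : Rel Carrier (ℓ₁ ⊔ ℓ₂)
  x < y = x ≤ y × ¬ (x ≈ y)

  _-_ : Op₂ Carrier
  x - y = x + (- y)

  _/_ : Op₂ Carrier
  x / y = x * y ⁻¹

  fromℕ : ℕ → Carrier
  fromℕ m = m · 1#

  field
    archimedean : ∀ x → ∃[ m ] x ≤ fromℕ m

  Σ[_] : List Carrier → Carrier
  Σ[ xs ] = foldr _+_ 0# xs

Clustering : ℕ → Set
Clustering n = List (Subset n)

infix 4 _≟_
_≟_ : ∀ {n} → DecidableEquality (Subset n)
_≟_ = ≡-dec _≟ᵇ_

Meets : ∀ {n} → Subset n → Subset n → Set
Meets A B = Nonempty (A ∩ B)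

meets? : ∀ {n} (A B : Subset n) → Dec (Meets A B)
meets? A B = nonempty? (A ∩ B)

record IsClustering {n} (C : Clustering n) : Set where
  field
    nonempty : All Nonempty C
    disjoint : AllPairs (λ A B → ¬ Meets A B) C
    covering : ∀ x → Any (x ∈_) C

infix 4 _≋_ _≋?_
_≋_ : ∀ {n} → Clustering n → Clustering n → Set
C ≋ D = All (_∈ˡ D) C × All (_∈ˡ C) D

_≋?_ : ∀ {n} (C D : Clustering n) → Dec (C ≋ D)
_≋?_ {n} C D = all? (_∈ˡ? D) C ×-dec all? (_∈ˡ? C) D
  where open DecMembership (_≟_ {n}) renaming (_∈?_ to _∈ˡ?_)

dist : ∀ {n} → Clustering n → Clustering n → ℕ
dist C D = sum (map (λ A → length (filter (meets? A) D) ∸ 1) C)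

data Tree (n : ℕ) : Set where
  leaf : Fin n → Tree n
  node : Tree n → Tree n → Tree n

⟦_⟧ : ∀ {n} → Tree n → Subset n
⟦ leaf x ⟧   = ⁅ x ⁆
⟦ node l r ⟧ = ⟦ l ⟧ ∪ ⟦ r ⟧

-- The deepest node of t containing Y, provided that t contains Y and Y is nonempty.
deepest : ∀ {n} → Tree n → Subset n → Tree n
deepest (leaf x)   Y = leaf x
deepest (node l r) Y with Y ⊆? ⟦ l ⟧ | Y ⊆? ⟦ r ⟧
... | yes _ | _     = deepest l Y
... | no _  | yes _ = deepest r Y
... | no _  | no _  = node l r

-- The leaf case does not arise when Y has at least two elements.
Split : ∀ {n} → Tree n → Subset n → Subset n × Subset n
Split T Y with deepest T Y
... | leaf x   = Y , Y
... | node l r = Y ∩ ⟦ l ⟧ , Y ∩ ⟦ r ⟧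

module Similarity {a ℓ₁ ℓ₂} (K : ArchimedeanOrderedField a ℓ₁ ℓ₂) where
  open ArchimedeanOrderedField K

  SimilarityFunction : ℕ → Set a
  SimilarityFunction n = Fin n → Fin n → Carrier

  Symmetric : ∀ {n} → SimilarityFunction n → Set ℓ₁
  Symmetric S = ∀ x y → S x y ≈ S y x

  elements : ∀ {n} → Subset n → List (Fin n)
  elements A = filter (_∈? A) (allFin _)

  average : ∀ {n} → SimilarityFunction n → Subset n → Subset n → Carrier
  average S A B =
    Σ[ map (λ x → Σ[ map (S x) (elements B) ]) (elements A) ] / fromℕ (∣ A ∣ ℕ.* ∣ B ∣)

  Stable : ∀ {n} → SimilarityFunction n → Clustering n → Set (ℓ₁ ⊔ ℓ₂)
  Stable S C* = ∀ {T T′} → T ∈ˡ C* → T′ ∈ˡ C* → T ≢ T′ →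
    ∀ A A′ → Nonempty A → A ⊂ T → Nonempty A′ → A′ ⊆ T′ →
    average S A A′ < average S A (T ─ A)

  data _⊢_⟶_ {n} (S : SimilarityFunction n) : List (Tree n) → List (Tree n) → Set (a ⊔ ℓ₁ ⊔ ℓ₂) where
    join : ∀ {F t u G} → F ↭ t ∷ u ∷ G →
           AllPairs (λ v w → average S ⟦ v ⟧ ⟦ w ⟧ ≤ average S ⟦ t ⟧ ⟦ u ⟧) F →
           S ⊢ F ⟶ (node t u ∷ G)

  IsAverageLinkageTree : ∀ {n} → SimilarityFunction n → Tree n → Set (a ⊔ ℓ₁ ⊔ ℓ₂)
  IsAverageLinkageTree S T = Star (S ⊢_⟶_) (map leaf (allFin _)) [ T ]

  -- m ≤ b · log₂ (max 2 x), in exponential form.  The maximum only matters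
  -- for x = k/ε < 2, that is for k = 1 and ε > 1/2, where
  -- log₂ (k/ε) tends to 0 as ε → 1 while a merge may be unavoidable.
  _≤_·log₂_ : ℕ → ℕ → Carrier → Set ℓ₂
  m ≤ b ·log₂ x = m ℕ.≤ b ⊎ fromℕ 2 ^ m ≤ x ^ b

  infix 4 _≤_·log₂_ _≤?_·log₂_
  _≤?_·log₂_ : ∀ m b x → Dec (m ≤ b ·log₂ x)
  m ≤? b ·log₂ x = (m ℕ.≤? b) ⊎-dec (fromℕ 2 ^ m ≤? x ^ b)

module Probability {a ℓ₁ ℓ₂} (K : ArchimedeanOrderedField a ℓ₁ ℓ₂) where
  open ArchimedeanOrderedField K

  -- Finitely supported distributions: outcomes with their weights.
  FinDist : ∀ {b} → Set b → Set (a ⊔ b)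
  FinDist A = List (A × Carrier)

  return : ∀ {b} {A : Set b} → A → FinDist A
  return x = [ x , 1# ]

  uniform : ∀ m → FinDist (Fin m)
  uniform m = map (λ i → i , fromℕ m ⁻¹) (allFin m)

  infixl 1 _>>=_
  _>>=_ : ∀ {b c} {A : Set b} {B : Set c} → FinDist A → (A → FinDist B) → FinDist B
  d >>= f = concatMap (λ (x , p) → map (map₂ (p *_)) (f x)) d

  Pr : ∀ {b p} {A : Set b} {P : Pred A p} → Decidable P → FinDist A → Carrier
  Pr P? d = Σ[ map proj₂ (filter (λ (x , _) → P? x) d) ]

-- C* is the target clustering, C₀ the initial one.
module Interaction {n} (T : Tree n) (C* C₀ : Clustering n) where

  Impure : Subset n → Set
  Impure A = ∃[ B ] ∃[ B′ ] B ∈ˡ C* × B′ ∈ˡ C* × B ≢ B′ × Meets A B × Meets A B′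

  unorderedPairs : Clustering n → List (Subset n × Subset n)
  unorderedPairs []      = []
  unorderedPairs (A ∷ C) = map (A ,_) C ++ unorderedPairs C

  MeetCommonTarget : Pred (Subset n × Subset n) _
  MeetCommonTarget (A , B) = Any (λ D → Meets D A × Meets D B) C*

  meetCommonTarget? : Decidable MeetCommonTarget
  meetCommonTarget? (A , B) = any? (λ D → meets? D A ×-dec meets? D B) C*

  mergePairs : Clustering n → List (Subset n × Subset n)
  mergePairs C = filter meetCommonTarget? (unorderedPairs C)

  delete : Subset n → Clustering n → Clustering n
  delete A = filter (λ B → ¬? (B ≟ A))

  splitCluster : Subset n → Clustering n → Clustering n
  splitCluster A C = let A₁ , A₂ = Split T A in A₁ ∷ A₂ ∷ delete A C

  mergeClusters : Subset n × Subset n → Clustering n → Clustering n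
  mergeClusters (A , B) C with Split T (A ∪ B)
  ... | A′ , B′ with (A′ ≟ A ×-dec B′ ≟ B) ⊎-dec (A′ ≟ B ×-dec B′ ≟ A)
  ...   | yes _ = A ∪ B ∷ delete A (delete B C)
  ...   | no _  = A′ ∷ B′ ∷ delete A (delete B C)

  -- The transcripts of allowed requests, indexed by the current clustering.
  data History : Clustering n → Set where
    start      : History C₀
    afterSplit : ∀ {C A} → History C → A ∈ˡ C → Impure A → History (splitCluster A C)
    afterMerge : ∀ {C} → History C → (i : Fin (length (mergePairs C))) →
                 History (mergeClusters (lookup (mergePairs C) i) C)

  splits : ∀ {C} → History C → ℕ
  splits start              = 0
  splits (afterSplit h _ _) = suc (splits h)
  splits (afterMerge h _)   = splits h

  merges : ∀ {C} → History C → ℕ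
  merges start              = 0
  merges (afterSplit h _ _) = merges h
  merges (afterMerge h _)   = suc (merges h)

  data Request (C : Clustering n) : Set where
    split : ∀ {A} → A ∈ˡ C → Impure A → Request C
    merge : mergePairs C ≢ [] → Request C

  -- A possibly adaptive adversary, who sees the whole transcript. Requiring an answer only at
  -- clusterings with a History matters: a list that is not a partition may
  -- differ from C* and still admit no request.
  Oracle : Set
  Oracle = ∀ {C} → History C → ¬ (C ≋ C*) → Request C

  module _ {a ℓ₁ ℓ₂} (K : ArchimedeanOrderedField a ℓ₁ ℓ₂) where
    open ArchimedeanOrderedField K using (Carrier)
    open Probability K
    open Similarity K

    continue : Oracle → ℕ → ∀ {C} → History C → FinDist (∃ History)
    continue O N {C} h with C ≋? C*
    continue O N       h | yes _ = return (_ , h)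
    continue O zero    h | no _  = return (_ , h)
    continue O (suc N) {C} h | no C≉C* with O h C≉C*
    ... | split A∈C A-impure = continue O N (afterSplit h A∈C A-impure)
    ... | merge _            = uniform (length (mergePairs C)) >>= λ i → continue O N (afterMerge h i)

    -- The process stopped on reaching C*, or after N requests.
    run : Oracle → ℕ → FinDist (∃ History)
    run O N = continue O N start

    FoundWithin : (s b : ℕ) (x : Carrier) → Pred (∃ History) _
    FoundWithin s b x (C , h) = C ≋ C* × splits h ℕ.≤ s × merges h ≤ b ·log₂ x

    foundWithin? : ∀ s b x → Decidable (FoundWithin s b x)
    foundWithin? s b x (C , h) = (C ≋? C*) ×-dec (splits h ℕ.≤? s) ×-dec (merges h ≤? b ·log₂ x)

{-# OPTIONS --safe #-}

-- By stability, every node of the average-linkage tree T is contained in, contains, or is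
-- disjoint from each target. Hence splitting a set that is not inside one target cuts no
-- target: the overclustering error drops with every split and never grows, which bounds the splits.
--
-- For a target D let p be the number of clusters meeting it, and call such a cluster bad if it
-- is not contained in D or straddles the two children of the tree node D. The potential sums
-- 2 (p - 1) + b over the targets with p ≥ 2, where b counts the bad clusters; it is at most 4 δᵤ.
-- No request increases it, and a merge request decreases it if one of its clusters is bad for a
-- common target, or if the two lie below different children of D. For each D there are at least
-- p - 1 such pairs: a star around a bad cluster, or the pairs across the two children. As D
-- contributes at most (p - 1)² pairs, a random merge request decreases the potential Φ with
-- probability at least 1 / δᵤ. So r^m 2^Φ is a supermartingale in the number m of merges for
-- r = 1 + 1 / (2 δᵤ + 1), and it bounds the probability of failure.

module Submission where

open import Defs
open import Data.Fin using (Fin)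
open import Data.List using (length)
open import Data.Nat using (ℕ) renaming (_*_ to _*ℕ_)
open import Data.Product using (∃-syntax)
open import Algebra.Bundles using (CommutativeRing)
import Algebra.Properties.CommutativeSemigroup as CommutativeSemigroupProperties
import Algebra.Properties.CommutativeSemiring.Exp as Exp
import Algebra.Properties.Ring as RingProperties
import Algebra.Properties.Semiring.Mult as Mult
open import Data.Empty using (⊥-elim)
open import Data.Fin using (zero; suc)
open import Data.Fin.Subset using (Subset; inside; outside; _∈_; _∉_; _⊆_; _∩_; _∪_; _─_; ∣_∣; ⁅_⁆; Nonempty; Empty)
open import Data.Fin.Subset.Properties
  using ( _∈?_; _⊆?_; nonempty?; Empty-unique; drop-there; x∈⁅x⁆; x∈⁅y⁆⇒x≡y
        ; ⊆-trans; ⊆-antisym; x∈p∩q⁺; x∈p∩q⁻; p∩q⊆p; p∩q⊆q; x∈p∪q⁺; x∈p∪q⁻; p⊆p∪q; q⊆p∪q; ∪-comm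
        ; p─q⊆p; x∈p∧x∉q⇒x∈p─q; ∣⊥∣≡0; ∣⁅x⁆∣≡1; p⊆q⇒∣p∣≤∣q∣)
open import Data.List using (List; []; _∷_; [_]; _++_; map; filter; lookup; allFin)
open import Data.List.Membership.Propositional using (find; lose) renaming (_∈_ to _∈ˡ_)
open import Data.List.Membership.Propositional.Properties using (∈-allFin; ∈-filter⁺; ∈-filter⁻; ∈-length; ∈-lookup)
open import Data.List.Properties
  using ( filter-++; filter-all; filter-none; filter-some; length-++; length-filter; length-tabulate
        ; map-++; map-∘; map-tabulate; tabulate-lookup)
open import Data.List.Relation.Binary.Permutation.Propositional
  using (_↭_; prep; swap; ↭-refl; ↭-trans; ↭⇒↭ₛ)
open import Data.List.Relation.Binary.Permutation.Propositional.Properties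
  using (All-resp-↭; Any-resp-↭; filter-↭; ↭-length) renaming (map⁺ to map-↭)
import Data.List.Relation.Binary.Permutation.Setoid.Properties as SetoidPermutation
open import Data.List.Relation.Unary.All as All using (All; []; _∷_)
import Data.List.Relation.Unary.All.Properties as All
open import Data.List.Relation.Unary.AllPairs as AllPairs using (AllPairs; []; _∷_)
import Data.List.Relation.Unary.AllPairs.Properties as AllPairs
open import Data.List.Relation.Unary.Any as Any using (Any; here; there; any?)
import Data.List.Relation.Unary.Any.Properties as Any
import Data.List.Relation.Unary.Unique.Propositional.Properties as Unique
open import Data.Nat as ℕ using (zero; suc; s≤s; z≤n)
open import Data.Nat.ListAction using (sum)
open import Data.Nat.ListAction.Properties using (sum-++; sum-↭)
import Data.Nat.Properties as ℕ
open import Data.Nat.Tactic.RingSolver using (solve-∀)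
open import Data.Product using (_×_; _,_; proj₁; proj₂; map₂)
open import Data.Sum using (_⊎_; inj₁; inj₂; [_,_]′)
open import Data.Vec using ([]; _∷_)
open import Function using (_∘_; id)
open import Relation.Binary.Bundles using (Poset)
open import Relation.Binary.Construct.Closure.ReflexiveTransitive using (Star; ε; _◅_)
open import Relation.Binary.Definitions using () renaming (Symmetric to IsSymmetric)
open import Relation.Binary.PropositionalEquality as ≡ using (_≡_; _≢_; refl)
import Relation.Binary.Reasoning.PartialOrder as PartialOrderReasoning
open import Relation.Binary.Structures using (IsDecTotalOrder)
open import Relation.Nullary using (¬_; Dec; yes; no)
open import Relation.Nullary.Decidable using (¬?; _×-dec_; _⊎-dec_)
open import Relation.Unary using (Pred; Decidable)

-- The number of clusters alone does not measure progress: a merge request inside a target may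
-- return two clusters for two. What improves then is that neither new part straddles the two
-- children of the node `D`, hence the term b. Conversely, a request that lowers p by 1 may create a
-- bad cluster, hence the weight 2 on p - 1. A target with p = 1 is left out because it adds nothing
-- to δᵤ, although its one cluster may well be bad.
--
-- The oracle is adaptive and interleaves splits, so merges are not independent trials; an
-- exponential potential handles this by plain induction along the process. A drop of Φ at least
-- halves 2^Φ, so a chance of 1 / (δᵤ + 1) leaves the mean factor 1 - 1 / (2 (δᵤ + 1)) = 1 / r.
-- Divided by 2^Φ₀ / ε, where Φ₀ is the initial potential, the supermartingale starts at ε, and it
-- is at least 1 as soon as r^m ≥ 2^Φ₀ / ε. As r^(2 δᵤ + 2) ≥ 2, about (2 δᵤ + 2) (Φ₀ + log₂ (1 /
-- ε)) merges are enough for this.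
--
-- Only finitely many requests are simulated. A run still unfinished at the cutoff counts as a
-- failure, and the cutoff is so late that the supermartingale is at least 1 there too.

-- Arithmetic in ordered fields

module OrderedField {a ℓ₁ ℓ₂} (K : ArchimedeanOrderedField a ℓ₁ ℓ₂) where
  open ArchimedeanOrderedField K public
  open IsDecTotalOrder isDecTotalOrder public
    using (total; antisym; isPartialOrder)
    renaming (refl to ≤-refl; trans to ≤-trans; reflexive to ≤-reflexive)
  open CommutativeRing commutativeRing public
    using ( semiring; commutativeSemiring; ring; +-commutativeSemigroup
          ; +-comm; +-assoc; +-identityˡ; +-identityʳ; +-cong; +-congˡ
          ; -‿inverseʳ; -‿cong; -‿inverseˡ; *-comm; *-assoc; *-identityˡ; *-identityʳ; *-cong; *-congˡ; *-congʳ
          ; distribˡ; distribʳ; zeroˡ; zeroʳ)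
    renaming (refl to ≈-refl; sym to ≈-sym; trans to ≈-trans; reflexive to ≈-reflexive)
  open Exp commutativeSemiring public using (^-homo-*; ^-assocʳ)
  open Mult semiring public using (×-homo-+; ×1-homo-*)
  open CommutativeSemigroupProperties +-commutativeSemigroup public
    using () renaming (interchange to +-interchange; x∙yz≈y∙xz to x+[y+z]≈y+[x+z])
  open RingProperties ring using (-‿distribʳ-*; -‿distribˡ-*; -‿involutive)

  poset : Poset a ℓ₁ ℓ₂
  poset = record { isPartialOrder = isPartialOrder }

  open PartialOrderReasoning poset public hiding (start; stop)

  ≰⇒≥ : ∀ {x y} → ¬ (x ≤ y) → y ≤ x
  ≰⇒≥ {x} {y} x≰y = [ (λ x≤y → ⊥-elim (x≰y x≤y)) , id ]′ (total x y)

  ≰⇒> : ∀ {x y} → ¬ (x ≤ y) → y < x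
  ≰⇒> x≰y = ≰⇒≥ x≰y , λ y≈x → x≰y (≤-reflexive (≈-sym y≈x))

  <⇒≱ : ∀ {x y} → x < y → ¬ (y ≤ x)
  <⇒≱ (x≤y , x≉y) y≤x = x≉y (antisym x≤y y≤x)

  +-monoʳ-≤ : ∀ z {x y} → x ≤ y → z + x ≤ z + y
  +-monoʳ-≤ z {x} {y} x≤y = begin
    z + x ≈⟨ +-comm z x ⟩
    x + z ≤⟨ +-monoˡ-≤ z x≤y ⟩
    y + z ≈⟨ +-comm y z ⟩
    z + y ∎

  +-mono-≤ : ∀ {x y u v} → x ≤ y → u ≤ v → x + u ≤ y + v
  +-mono-≤ {y = y} {u = u} x≤y u≤v = ≤-trans (+-monoˡ-≤ u x≤y) (+-monoʳ-≤ y u≤v)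

  x+z-z≈x : ∀ x z → x + z - z ≈ x
  x+z-z≈x x z = ≈-trans (+-assoc x z (- z)) (≈-trans (+-congˡ (-‿inverseʳ z)) (+-identityʳ x))

  x-z+z≈x : ∀ x z → x - z + z ≈ x
  x-z+z≈x x z = ≈-trans (+-assoc x (- z) z) (≈-trans (+-congˡ (-‿inverseˡ z)) (+-identityʳ x))

  +-cancelʳ-≤ : ∀ z {x y} → x + z ≤ y + z → x ≤ y
  +-cancelʳ-≤ z {x} {y} le = begin
    x           ≈⟨ x+z-z≈x x z ⟨
    x + z - z   ≤⟨ +-monoˡ-≤ (- z) le ⟩
    y + z - z   ≈⟨ x+z-z≈x y z ⟩
    y           ∎

  x≤y⇒0≤y-x : ∀ {x y} → x ≤ y → 0# ≤ y - x
  x≤y⇒0≤y-x {x} {y} x≤y = begin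
    0#    ≈⟨ -‿inverseʳ x ⟨
    x - x ≤⟨ +-monoˡ-≤ (- x) x≤y ⟩
    y - x ∎

  x+y≥z⇒x≥z-y : ∀ {x y z} → z ≤ x + y → z - y ≤ x
  x+y≥z⇒x≥z-y {x} {y} {z} le = begin
    z - y     ≤⟨ +-monoˡ-≤ (- y) le ⟩
    x + y - y ≈⟨ x+z-z≈x x y ⟩
    x         ∎

  x≥z-y⇒x+y≥z : ∀ {x y z} → z - y ≤ x → z ≤ x + y
  x≥z-y⇒x+y≥z {x} {y} {z} le = begin
    z         ≈⟨ x-z+z≈x z y ⟨
    z - y + y ≤⟨ +-monoˡ-≤ y le ⟩
    x + y     ∎

  *-monoˡ-≤ : ∀ {z x y} → 0# ≤ z → x ≤ y → z * x ≤ z * y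
  *-monoˡ-≤ {z} {x} {y} 0≤z x≤y = begin
    z * x                 ≈⟨ +-identityˡ (z * x) ⟨
    0# + z * x            ≤⟨ +-monoˡ-≤ (z * x) (*-nonNeg 0≤z (x≤y⇒0≤y-x x≤y)) ⟩
    z * (y - x) + z * x   ≈⟨ distribˡ z (y - x) x ⟨
    z * (y - x + x)       ≈⟨ *-congˡ (x-z+z≈x y x) ⟩
    z * y                 ∎

  *-monoʳ-≤ : ∀ {z x y} → 0# ≤ z → x ≤ y → x * z ≤ y * z
  *-monoʳ-≤ {z} {x} {y} 0≤z x≤y = begin
    x * z ≈⟨ *-comm x z ⟩
    z * x ≤⟨ *-monoˡ-≤ 0≤z x≤y ⟩
    z * y ≈⟨ *-comm z y ⟩
    y * z ∎

  *-mono-≤ : ∀ {x y u v} → 0# ≤ x → 0# ≤ v → x ≤ y → u ≤ v → x * u ≤ y * v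
  *-mono-≤ 0≤x 0≤v x≤y u≤v = ≤-trans (*-monoˡ-≤ 0≤x u≤v) (*-monoʳ-≤ 0≤v x≤y)

  0≤x² : ∀ x → 0# ≤ x * x
  0≤x² x with total 0# x
  ... | inj₁ 0≤x = *-nonNeg 0≤x 0≤x
  ... | inj₂ x≤0 = begin
    0#            ≤⟨ *-nonNeg 0≤-x 0≤-x ⟩
    - x * - x     ≈⟨ -‿distribˡ-* x (- x) ⟨
    - (x * - x)   ≈⟨ -‿cong (-‿distribʳ-* x x) ⟨
    - - (x * x)   ≈⟨ -‿involutive (x * x) ⟩
    x * x         ∎
    where
    0≤-x : 0# ≤ - x
    0≤-x = ≤-trans (x≤y⇒0≤y-x x≤0) (≤-reflexive (+-identityˡ (- x)))

  0≤1 : 0# ≤ 1#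
  0≤1 = ≤-trans (0≤x² 1#) (≤-reflexive (*-identityˡ 1#))

  0<1 : 0# < 1#
  0<1 = 0≤1 , 0≉1

  <⇒≉0 : ∀ {x} → 0# < x → ¬ (x ≈ 0#)
  <⇒≉0 (_ , 0≉x) x≈0 = 0≉x (≈-sym x≈0)

  *-inverseˡ : ∀ {x} → 0# < x → x ⁻¹ * x ≈ 1#
  *-inverseˡ {x} 0<x = ≈-trans (*-comm _ x) (*-inverseʳ x (<⇒≉0 0<x))

  x/y*y≈x : ∀ x {y} → 0# < y → x / y * y ≈ x
  x/y*y≈x x {y} 0<y = ≈-trans (*-assoc x _ y) (≈-trans (*-congˡ (*-inverseˡ 0<y)) (*-identityʳ x))

  0≤x⁻¹ : ∀ {x} → 0# < x → 0# ≤ x ⁻¹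
  0≤x⁻¹ {x} 0<x = begin
    0#                  ≤⟨ *-nonNeg (proj₁ 0<x) (0≤x² (x ⁻¹)) ⟩
    x * (x ⁻¹ * x ⁻¹)   ≈⟨ *-assoc x _ _ ⟨
    x * x ⁻¹ * x ⁻¹     ≈⟨ *-congʳ (*-inverseʳ x (<⇒≉0 0<x)) ⟩
    1# * x ⁻¹           ≈⟨ *-identityˡ _ ⟩
    x ⁻¹                ∎

  *-cancelʳ-≤ : ∀ {z x y} → 0# < z → x * z ≤ y * z → x ≤ y
  *-cancelʳ-≤ {z} {x} {y} 0<z le = begin
    x               ≈⟨ lemma x ⟨
    x * z * z ⁻¹    ≤⟨ *-monoʳ-≤ (0≤x⁻¹ 0<z) le ⟩
    y * z * z ⁻¹    ≈⟨ lemma y ⟩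
    y               ∎
    where
    lemma : ∀ w → w * z * z ⁻¹ ≈ w
    lemma w = ≈-trans (*-assoc w z _) (≈-trans (*-congˡ (*-inverseʳ z (<⇒≉0 0<z))) (*-identityʳ w))

  x/y≤z⇒x≤z*y : ∀ {x y z} → 0# < y → x / y ≤ z → x ≤ z * y
  x/y≤z⇒x≤z*y {x} {y} {z} 0<y le = begin
    x           ≈⟨ x/y*y≈x x 0<y ⟨
    x / y * y   ≤⟨ *-monoʳ-≤ (proj₁ 0<y) le ⟩
    z * y       ∎

  x≤z*y⇒x/y≤z : ∀ {x y z} → 0# < y → x ≤ z * y → x / y ≤ z
  x≤z*y⇒x/y≤z {x} {y} {z} 0<y le =
    *-cancelʳ-≤ 0<y (≤-trans (≤-reflexive (x/y*y≈x x 0<y)) le)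

  *-monoʳ-< : ∀ {z x y} → 0# < z → x < y → x * z < y * z
  *-monoʳ-< 0<z x<y = ≰⇒> (λ le → <⇒≱ x<y (*-cancelʳ-≤ 0<z le))

  +-mono-<-≤ : ∀ {x y u v} → x < y → u ≤ v → x + u < y + v
  +-mono-<-≤ {x} {y} {u} {v} x<y u≤v = ≰⇒> λ le →
    <⇒≱ x<y (+-cancelʳ-≤ u (≤-trans (+-monoʳ-≤ y u≤v) le))

  fromℕ-homo-+ : ∀ m n → fromℕ (m ℕ.+ n) ≈ fromℕ m + fromℕ n
  fromℕ-homo-+ = ×-homo-+ 1#

  fromℕ-homo-* : ∀ m n → fromℕ (m ℕ.* n) ≈ fromℕ m * fromℕ n
  fromℕ-homo-* = ×1-homo-*

  0≤fromℕ : ∀ m → 0# ≤ fromℕ m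
  0≤fromℕ zero    = ≤-refl
  0≤fromℕ (suc m) = begin
    0#            ≈⟨ +-identityˡ 0# ⟨
    0# + 0#       ≤⟨ +-mono-≤ 0≤1 (0≤fromℕ m) ⟩
    1# + fromℕ m  ∎

  fromℕ-mono-≤ : ∀ {m n} → m ℕ.≤ n → fromℕ m ≤ fromℕ n
  fromℕ-mono-≤ {n = n} z≤n = 0≤fromℕ n
  fromℕ-mono-≤ (s≤s m≤n)   = +-monoʳ-≤ 1# (fromℕ-mono-≤ m≤n)

  fromℕ-1 : fromℕ 1 ≈ 1#
  fromℕ-1 = +-identityʳ 1#

  1≤fromℕ : ∀ {m} → 1 ℕ.≤ m → 1# ≤ fromℕ m
  1≤fromℕ 1≤m = ≤-trans (≤-reflexive (≈-sym fromℕ-1)) (fromℕ-mono-≤ 1≤m)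

  <-≤-trans : ∀ {x y z} → x < y → y ≤ z → x < z
  <-≤-trans x<y y≤z = ≰⇒> (λ z≤x → <⇒≱ x<y (≤-trans y≤z z≤x))

  0<fromℕ : ∀ {m} → 1 ℕ.≤ m → 0# < fromℕ m
  0<fromℕ 1≤m = <-≤-trans 0<1 (1≤fromℕ 1≤m)

  fromℕ-^ : ∀ m n → fromℕ (m ℕ.^ n) ≈ fromℕ m ^ n
  fromℕ-^ m zero    = fromℕ-1
  fromℕ-^ m (suc n) = ≈-trans (fromℕ-homo-* m (m ℕ.^ n)) (*-congˡ (fromℕ-^ m n))

  0≤^ : ∀ n {x} → 0# ≤ x → 0# ≤ x ^ n
  0≤^ zero    0≤x = 0≤1
  0≤^ (suc n) 0≤x = *-nonNeg 0≤x (0≤^ n 0≤x)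

  ^-mono-≤ : ∀ n {x y} → 0# ≤ x → x ≤ y → x ^ n ≤ y ^ n
  ^-mono-≤ zero    0≤x x≤y = ≤-refl
  ^-mono-≤ (suc n) 0≤x x≤y = *-mono-≤ 0≤x (0≤^ n (≤-trans 0≤x x≤y)) x≤y (^-mono-≤ n 0≤x x≤y)

  1≤^ : ∀ n {x} → 1# ≤ x → 1# ≤ x ^ n
  1≤^ zero    1≤x = ≤-refl
  1≤^ (suc n) {x} 1≤x = begin
    1#         ≈⟨ *-identityˡ 1# ⟨
    1# * 1#    ≤⟨ *-mono-≤ 0≤1 (0≤^ n (≤-trans 0≤1 1≤x)) 1≤x (1≤^ n 1≤x) ⟩
    x * x ^ n  ∎

  ^-monoʳ-≤ : ∀ {x} → 1# ≤ x → ∀ {m n} → m ℕ.≤ n → x ^ m ≤ x ^ n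
  ^-monoʳ-≤ 1≤x {n = n} z≤n = 1≤^ n 1≤x
  ^-monoʳ-≤ 1≤x (s≤s m≤n)   = *-monoˡ-≤ (≤-trans 0≤1 1≤x) (^-monoʳ-≤ 1≤x m≤n)

  0<* : ∀ {x y} → 0# < x → 0# < y → 0# < x * y
  0<* {x} {y} 0<x 0<y = *-nonNeg (proj₁ 0<x) (proj₁ 0<y) , λ 0≈xy →
    proj₂ 0<x (antisym (proj₁ 0<x) (*-cancelʳ-≤ 0<y (≤-reflexive (≈-trans (≈-sym 0≈xy) (≈-sym (zeroˡ y))))))

  0<^ : ∀ n {x} → 0# < x → 0# < x ^ n
  0<^ zero    0<x = 0<1
  0<^ (suc n) 0<x = 0<* 0<x (0<^ n 0<x)

  ^-cancel-≤ : ∀ n {x y} → 0# ≤ x → 0# ≤ y → x ^ suc n ≤ y ^ suc n → x ≤ y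
  ^-cancel-≤ n {x} {y} 0≤x 0≤y le with x ≤? y
  ... | yes x≤y = x≤y
  ... | no x≰y = ⊥-elim (<⇒≱ y^<x^ le)
    where
    y<x = ≰⇒> x≰y
    0<x : 0# < x
    0<x = ≰⇒> λ x≤0 → x≰y (≤-trans x≤0 0≤y)
    y^<x^ : y ^ suc n < x ^ suc n
    y^<x^ = begin-strict
      y * y ^ n ≤⟨ *-monoˡ-≤ 0≤y (^-mono-≤ n 0≤y (proj₁ y<x)) ⟩
      y * x ^ n <⟨ *-monoʳ-< (0<^ n 0<x) y<x ⟩
      x * x ^ n ∎

  Σ-++ : ∀ xs ys → Σ[ xs ++ ys ] ≈ Σ[ xs ] + Σ[ ys ]
  Σ-++ []       ys = ≈-sym (+-identityˡ _)
  Σ-++ (x ∷ xs) ys = ≈-trans (+-congˡ (Σ-++ xs ys)) (≈-sym (+-assoc x _ _))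

  module _ {b} {A : Set b} where
    Σ-mono-≤ : ∀ (f g : A → Carrier) xs → (∀ x → f x ≤ g x) → Σ[ map f xs ] ≤ Σ[ map g xs ]
    Σ-mono-≤ f g []       f≤g = ≤-refl
    Σ-mono-≤ f g (x ∷ xs) f≤g = +-mono-≤ (f≤g x) (Σ-mono-≤ f g xs f≤g)

    Σ-cong : ∀ {f g : A → Carrier} xs → (∀ x → f x ≈ g x) → Σ[ map f xs ] ≈ Σ[ map g xs ]
    Σ-cong []       f≈g = ≈-refl
    Σ-cong (x ∷ xs) f≈g = +-cong (f≈g x) (Σ-cong xs f≈g)

    Σ-distrib-+ : ∀ (f g : A → Carrier) xs → Σ[ map (λ x → f x + g x) xs ] ≈ Σ[ map f xs ] + Σ[ map g xs ]
    Σ-distrib-+ f g []       = ≈-sym (+-identityˡ 0#)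
    Σ-distrib-+ f g (x ∷ xs) = begin-equality
      f x + g x + Σ[ map (λ x → f x + g x) xs ]         ≈⟨ +-congˡ (Σ-distrib-+ f g xs) ⟩
      f x + g x + (Σ[ map f xs ] + Σ[ map g xs ])       ≈⟨ +-interchange (f x) (g x) _ _ ⟩
      f x + Σ[ map f xs ] + (g x + Σ[ map g xs ])       ∎

    Σ-distribˡ-* : ∀ c (f : A → Carrier) xs → Σ[ map (λ x → c * f x) xs ] ≈ c * Σ[ map f xs ]
    Σ-distribˡ-* c f []       = ≈-sym (zeroʳ c)
    Σ-distribˡ-* c f (x ∷ xs) = ≈-trans (+-congˡ (Σ-distribˡ-* c f xs)) (≈-sym (distribˡ c _ _))

-- Finite subsets, pairwise relations on lists, and clusterings

x∈p─q⁻ : ∀ {n} {x : Fin n} (p q : Subset n) → x ∈ p ─ q → x ∉ q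
x∈p─q⁻ {x = suc x} (_ ∷ p) (inside ∷ q)  x∈ x∈q = x∈p─q⁻ p q (drop-there x∈) (drop-there x∈q)
x∈p─q⁻ {x = suc x} (_ ∷ p) (outside ∷ q) x∈ x∈q = x∈p─q⁻ p q (drop-there x∈) (drop-there x∈q)
x∈p─q⁻ {x = zero}  (_ ∷ p) (inside ∷ q)  () x∈q
x∈p─q⁻ {x = zero}  (_ ∷ p) (outside ∷ q) x∈ ()

module _ {n : ℕ} where
  meet : ∀ {A B : Subset n} {x} → x ∈ A → x ∈ B → Meets A B
  meet x∈A x∈B = _ , x∈p∩q⁺ (x∈A , x∈B)

  unmeet : ∀ {A B : Subset n} → Meets A B → ∃[ x ] x ∈ A × x ∈ B
  unmeet {A} {B} (x , x∈A∩B) = x , x∈p∩q⁻ A B x∈A∩B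

  Meets-sym : ∀ {A B : Subset n} → Meets A B → Meets B A
  Meets-sym m with x , x∈A , x∈B ← unmeet m = meet x∈B x∈A

  Meets-mono : ∀ {A A′ B B′ : Subset n} → A ⊆ A′ → B ⊆ B′ → Meets A B → Meets A′ B′
  Meets-mono A⊆A′ B⊆B′ m with x , x∈A , x∈B ← unmeet m = meet (A⊆A′ x∈A) (B⊆B′ x∈B)

  Disjoint : Subset n → Subset n → Set
  Disjoint A B = ¬ Meets A B

  Disjoint-sym : ∀ {A B : Subset n} → Disjoint A B → Disjoint B A
  Disjoint-sym A∥B = A∥B ∘ Meets-sym

  ∪-lub : ∀ {A B C : Subset n} → A ⊆ C → B ⊆ C → A ∪ B ⊆ C
  ∪-lub {A} {B} A⊆C B⊆C x∈ = [ A⊆C , B⊆C ]′ (x∈p∪q⁻ A B x∈)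

  ⊈-witness : ∀ {A B : Subset n} → ¬ (A ⊆ B) → ∃[ x ] x ∈ A × x ∉ B
  ⊈-witness {A} {B} A⊈B with nonempty? (A ─ B)
  ... | yes (x , x∈) = x , p─q⊆p A B x∈ , x∈p─q⁻ A B x∈
  ... | no  empty    = ⊥-elim (A⊈B λ {x} x∈A → help x x∈A (x ∈? B))
    where
    help : ∀ x → x ∈ A → Dec (x ∈ B) → x ∈ B
    help x x∈A (yes x∈B) = x∈B
    help x x∈A (no x∉B)  = ⊥-elim (empty (x , x∈p∧x∉q⇒x∈p─q x∈A x∉B))

∣p∣≡∣p∩q∣+∣p─q∣ : ∀ {n} (p q : Subset n) → ∣ p ∣ ≡ ∣ p ∩ q ∣ ℕ.+ ∣ p ─ q ∣
∣p∣≡∣p∩q∣+∣p─q∣ []            []            = refl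
∣p∣≡∣p∩q∣+∣p─q∣ (inside ∷ p)  (inside ∷ q)  = ≡.cong suc (∣p∣≡∣p∩q∣+∣p─q∣ p q)
∣p∣≡∣p∩q∣+∣p─q∣ (inside ∷ p)  (outside ∷ q) =
  ≡.trans (≡.cong suc (∣p∣≡∣p∩q∣+∣p─q∣ p q)) (≡.sym (ℕ.+-suc _ _))
∣p∣≡∣p∩q∣+∣p─q∣ (outside ∷ p) (inside ∷ q)  = ∣p∣≡∣p∩q∣+∣p─q∣ p q
∣p∣≡∣p∩q∣+∣p─q∣ (outside ∷ p) (outside ∷ q) = ∣p∣≡∣p∩q∣+∣p─q∣ p q

nonempty⇒1≤∣A∣ : ∀ {n} {A : Subset n} → Nonempty A → 1 ℕ.≤ ∣ A ∣
nonempty⇒1≤∣A∣ {A = A} (x , x∈A) = ≡.subst (ℕ._≤ ∣ A ∣) (∣⁅x⁆∣≡1 x)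
  (p⊆q⇒∣p∣≤∣q∣ λ y∈ → ≡.subst (_∈ A) (≡.sym (x∈⁅y⁆⇒x≡y x y∈)) x∈A)

module _ {a} {A : Set a} where
  AllPairs-resp-↭ : ∀ {r} {R : A → A → Set r} → IsSymmetric R → ∀ {xs ys} → xs ↭ ys → AllPairs R xs → AllPairs R ys
  AllPairs-resp-↭ {R = R} R-sym xs↭ys =
    SetoidPermutation.AllPairs-resp-↭ (≡.setoid A) R-sym (≡.resp₂ R) (↭⇒↭ₛ xs↭ys)

  AllPairs-lookup : ∀ {r} {R : A → A → Set r} → IsSymmetric R →
                    ∀ {xs} → AllPairs R xs → ∀ {x y} → x ∈ˡ xs → y ∈ˡ xs → x ≢ y → R x y
  AllPairs-lookup R-sym (_ ∷ _)   (here refl) (here refl) x≢y = ⊥-elim (x≢y refl)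
  AllPairs-lookup R-sym (Rx ∷ _)  (here refl) (there y∈)  x≢y = All.lookup Rx y∈
  AllPairs-lookup R-sym (Ry ∷ _)  (there x∈)  (here refl) x≢y = R-sym (All.lookup Ry x∈)
  AllPairs-lookup R-sym (_ ∷ Rxs) (there x∈)  (there y∈)  x≢y = AllPairs-lookup R-sym Rxs x∈ y∈ x≢y

Compatible : ∀ {n} → Subset n → Subset n → Set
Compatible U D = U ⊆ D ⊎ D ⊆ U ⊎ Disjoint U D

module _ {n} {C : Clustering n} (C-cl : IsClustering C) where
  open IsClustering C-cl

  distinct⇒disjoint : ∀ {A B} → A ∈ˡ C → B ∈ˡ C → A ≢ B → Disjoint A B
  distinct⇒disjoint = AllPairs-lookup Disjoint-sym disjoint

  meets⇒≡ : ∀ {A B} → A ∈ˡ C → B ∈ˡ C → Meets A B → A ≡ B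
  meets⇒≡ {A} {B} A∈ B∈ m with A ≟ B
  ... | yes A≡B = A≡B
  ... | no A≢B  = ⊥-elim (distinct⇒disjoint A∈ B∈ A≢B m)

  clusterOf : ∀ x → ∃[ A ] A ∈ˡ C × x ∈ A
  clusterOf x = find (covering x)

-- Trees that cut no target

-- Compatibility is stored at inner nodes only, since a singleton is compatible with every set.
data Laminar {n} (C* : Clustering n) : Tree n → Set where
  leaf : ∀ x → Laminar C* (leaf x)
  node : ∀ {l r} → Laminar C* l → Laminar C* r → Disjoint ⟦ l ⟧ ⟦ r ⟧ →
         (∀ {D} → D ∈ˡ C* → Compatible (⟦ l ⟧ ∪ ⟦ r ⟧) D) → Laminar C* (node l r)

module _ {n} {C* : Clustering n} where
  laminar⇒compatible : ∀ {t} → Laminar C* t → ∀ {D} → D ∈ˡ C* → Compatible ⟦ t ⟧ D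
  laminar⇒compatible (leaf x) {D} _ with x ∈? D
  ... | yes x∈D = inj₁ λ y∈ → ≡.subst (_∈ D) (≡.sym (x∈⁅y⁆⇒x≡y x y∈)) x∈D
  ... | no x∉D  = inj₂ (inj₂ λ m → let y , y∈x , y∈D = unmeet m in
                          x∉D (≡.subst (_∈ D) (x∈⁅y⁆⇒x≡y x y∈x) y∈D))
  laminar⇒compatible (node _ _ _ comp) D∈ = comp D∈

tree-nonempty : ∀ {n} (t : Tree n) → Nonempty ⟦ t ⟧
tree-nonempty (leaf x)   = x , x∈⁅x⁆ x
tree-nonempty (node l r) = let x , x∈ = tree-nonempty l in x , x∈p∪q⁺ (inj₁ x∈)

-- Stability makes the average-linkage tree laminar

module AverageLinkage {a ℓ₁ ℓ₂} (K : ArchimedeanOrderedField a ℓ₁ ℓ₂) {n : ℕ} where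
  open OrderedField K
  open Similarity K

  module _ (S : SimilarityFunction n) where
    weight : Subset n → Subset n → Carrier
    weight A B = Σ[ map (λ x → Σ[ map (S x) (elements B) ]) (elements A) ]

    Σ-elements-split : ∀ (f : Fin n → Carrier) B P xs →
      Σ[ map f (filter (_∈? B) xs) ] ≈ Σ[ map f (filter (_∈? (B ∩ P)) xs) ] + Σ[ map f (filter (_∈? (B ─ P)) xs) ]
    Σ-elements-split f B P []       = ≈-sym (+-identityˡ 0#)
    Σ-elements-split f B P (x ∷ xs) with x ∈? B | x ∈? (B ∩ P) | x ∈? (B ─ P)
    ... | yes _   | yes _    | no _     = ≈-trans (+-congˡ (Σ-elements-split f B P xs)) (≈-sym (+-assoc _ _ _))
    ... | yes _   | no _     | yes _    =
      ≈-trans (+-congˡ (Σ-elements-split f B P xs)) (x+[y+z]≈y+[x+z] _ _ _)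
    ... | no _    | no _     | no _     = Σ-elements-split f B P xs
    ... | yes _   | yes x∈BP | yes x∈BP′ = ⊥-elim (x∈p─q⁻ B P x∈BP′ (p∩q⊆q B P x∈BP))
    ... | yes x∈B | no x∉BP  | no x∉BP′ with x ∈? P
    ...   | yes x∈P = ⊥-elim (x∉BP (x∈p∩q⁺ (x∈B , x∈P)))
    ...   | no x∉P  = ⊥-elim (x∉BP′ (x∈p∧x∉q⇒x∈p─q x∈B x∉P))
    Σ-elements-split f B P (x ∷ xs) | no x∉B  | yes x∈BP | _        = ⊥-elim (x∉B (p∩q⊆p B P x∈BP))
    Σ-elements-split f B P (x ∷ xs) | no x∉B  | _        | yes x∈BP = ⊥-elim (x∉B (p─q⊆p B P x∈BP))

    weight-split : ∀ A B P → weight A B ≈ weight A (B ∩ P) + weight A (B ─ P)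
    weight-split A B P = ≈-trans
      (Σ-cong (elements A) λ x → Σ-elements-split (S x) B P (allFin n))
      (Σ-distrib-+ _ _ (elements A))

    Σ-swap : ∀ xs ys → Σ[ map (λ x → Σ[ map (S x) ys ]) xs ] ≈ Σ[ map (λ y → Σ[ map (λ x → S x y) xs ]) ys ]
    Σ-swap [] ys = Σ0 ys
      where
      Σ0 : ∀ (ys : List (Fin n)) → 0# ≈ Σ[ map (λ _ → 0#) ys ]
      Σ0 []       = ≈-refl
      Σ0 (_ ∷ ys) = ≈-trans (Σ0 ys) (≈-sym (+-identityˡ _))
    Σ-swap (x ∷ xs) ys = ≈-trans (+-congˡ (Σ-swap xs ys)) (≈-sym (Σ-distrib-+ (S x) _ ys))

    average-sym : Symmetric S → ∀ A B → average S A B ≈ average S B A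
    average-sym S-sym A B = *-cong
      (≈-trans (Σ-cong (elements A) λ x → Σ-cong (elements B) λ y → S-sym x y)
               (≈-sym (Σ-swap (elements B) (elements A))))
      (⁻¹-cong (≈-reflexive (≡.cong fromℕ (ℕ.*-comm ∣ A ∣ ∣ B ∣))))

    -- For A, B nonempty: average S A B ≤ M, without the division.
    AverageAtMost : Carrier → Subset n → Subset n → Set ℓ₂
    AverageAtMost M A B = weight A B ≤ M * fromℕ (∣ A ∣ ℕ.* ∣ B ∣)

    0<∣A∣∣B∣ : ∀ {A B : Subset n} → Nonempty A → Nonempty B → 0# < fromℕ (∣ A ∣ ℕ.* ∣ B ∣)
    0<∣A∣∣B∣ {A} {B} A≠∅ B≠∅ =
      0<fromℕ {∣ A ∣ ℕ.* ∣ B ∣} (ℕ.*-mono-≤ (nonempty⇒1≤∣A∣ {A = A} A≠∅) (nonempty⇒1≤∣A∣ {A = B} B≠∅))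

    average-≤⁺ : ∀ {M A B} → Nonempty A → Nonempty B → average S A B ≤ M → AverageAtMost M A B
    average-≤⁺ {A = A} {B} A≠∅ B≠∅ = x/y≤z⇒x≤z*y (0<∣A∣∣B∣ {A} {B} A≠∅ B≠∅)

    average-≤⁻ : ∀ {M A B} → Nonempty A → Nonempty B → AverageAtMost M A B → average S A B ≤ M
    average-≤⁻ {A = A} {B} A≠∅ B≠∅ = x≤z*y⇒x/y≤z (0<∣A∣∣B∣ {A} {B} A≠∅ B≠∅)

    sizes-split : ∀ M (A B P : Subset n) → M * fromℕ (∣ A ∣ ℕ.* ∣ B ∣) ≈
                  M * fromℕ (∣ A ∣ ℕ.* ∣ B ∩ P ∣) + M * fromℕ (∣ A ∣ ℕ.* ∣ B ─ P ∣)
    sizes-split M A B P = ≈-trans (*-congˡ (≈-trans (≈-reflexive (≡.cong fromℕ eq)) (fromℕ-homo-+ (∣ A ∣ ℕ.* ∣ B ∩ P ∣) _))) (distribˡ M _ _)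
      where
      eq : ∣ A ∣ ℕ.* ∣ B ∣ ≡ ∣ A ∣ ℕ.* ∣ B ∩ P ∣ ℕ.+ ∣ A ∣ ℕ.* ∣ B ─ P ∣
      eq = ≡.trans (≡.cong (∣ A ∣ ℕ.*_) (∣p∣≡∣p∩q∣+∣p─q∣ B P)) (ℕ.*-distribˡ-+ ∣ A ∣ ∣ B ∩ P ∣ _)

    atMost-split : ∀ {M A} B P → AverageAtMost M A (B ∩ P) → AverageAtMost M A (B ─ P) → AverageAtMost M A B
    atMost-split {M} {A} B P le₁ le₂ = begin
      weight A B                              ≈⟨ weight-split A B P ⟩
      weight A (B ∩ P) + weight A (B ─ P)     ≤⟨ +-mono-≤ le₁ le₂ ⟩
      M * fromℕ (∣ A ∣ ℕ.* ∣ B ∩ P ∣) + M * fromℕ (∣ A ∣ ℕ.* ∣ B ─ P ∣) ≈⟨ sizes-split M A B P ⟨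
      M * fromℕ (∣ A ∣ ℕ.* ∣ B ∣)             ∎

    -- With the denominator cleared, both sides vanish. Pieces of a partition that happen to be
    -- empty are therefore harmless.
    atMost-empty : ∀ {M A B} → Empty B → AverageAtMost M A B
    atMost-empty {M} {A} {B} B=∅ = begin
      weight A B                     ≈⟨ Σ-cong (elements A) (λ x → ≈-reflexive (≡.cong (λ ys → Σ[ map (S x) ys ]) elements≡[])) ⟩
      Σ[ map (λ _ → 0#) (elements A) ] ≈⟨ Σ0 (elements A) ⟩
      0#                             ≈⟨ zeroʳ M ⟨
      M * 0#                         ≈⟨ *-congˡ (≈-reflexive (≡.cong fromℕ sizes)) ⟨
      M * fromℕ (∣ A ∣ ℕ.* ∣ B ∣)    ∎
      where
      elements≡[] : elements B ≡ []
      elements≡[] = filter-none (_∈? B) (All.universal (λ x x∈B → B=∅ (x , x∈B)) (allFin n))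
      Σ0 : ∀ (xs : List (Fin n)) → Σ[ map (λ _ → 0#) xs ] ≈ 0#
      Σ0 []       = ≈-refl
      Σ0 (_ ∷ xs) = ≈-trans (+-identityˡ _) (Σ0 xs)
      sizes : ∣ A ∣ ℕ.* ∣ B ∣ ≡ 0
      sizes = ≡.trans (≡.cong (∣ A ∣ ℕ.*_) (≡.trans (≡.cong ∣_∣ (Empty-unique B=∅)) (∣⊥∣≡0 n))) (ℕ.*-zeroʳ ∣ A ∣)

    -- Peel off one piece at a time. By disjointness the later pieces meet the remainder of `B`
    -- exactly as they meet `B`. It is applied to the forest nodes covering `R` and to the targets
    -- covering part of `u`.
    atMost-cover : ∀ {M A} Ps B → (∀ {x} → x ∈ B → Any (x ∈_) Ps) → AllPairs Disjoint Ps →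
                   All (λ P → AverageAtMost M A (B ∩ P)) Ps → AverageAtMost M A B
    atMost-cover [] B cov dis les = atMost-empty λ (x , x∈B) → Any.¬Any[] (cov x∈B)
    atMost-cover {M} {A} (P ∷ Ps) B cov (P∥Ps ∷ dis) (le ∷ les) =
      atMost-split B P le (atMost-cover Ps (B ─ P) cov′ dis (All.zipWith restrict (P∥Ps , les)))
      where
      cov′ : ∀ {x} → x ∈ B ─ P → Any (x ∈_) Ps
      cov′ x∈ with cov (p─q⊆p B P x∈)
      ... | here x∈P = ⊥-elim (x∈p─q⁻ B P x∈ x∈P)
      ... | there p  = p
      restrict : ∀ {Q} → Disjoint P Q × AverageAtMost M A (B ∩ Q) → AverageAtMost M A ((B ─ P) ∩ Q)
      restrict {Q} (P∥Q , le′) = ≡.subst (AverageAtMost M A) (⊆-antisym to from) le′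
        where
        to : B ∩ Q ⊆ (B ─ P) ∩ Q
        to x∈ = let x∈B , x∈Q = x∈p∩q⁻ B Q x∈ in
          x∈p∩q⁺ (x∈p∧x∉q⇒x∈p─q x∈B (λ x∈P → P∥Q (meet x∈P x∈Q)) , x∈Q)
        from : (B ─ P) ∩ Q ⊆ B ∩ Q
        from x∈ = let x∈B , x∈Q = x∈p∩q⁻ (B ─ P) Q x∈ in x∈p∩q⁺ (p─q⊆p B P x∈B , x∈Q)

    record IsForest (C* : Clustering n) (F : List (Tree n)) : Set where
      field
        laminar  : All (Laminar C*) F
        disjoint : AllPairs (λ t u → Disjoint ⟦ t ⟧ ⟦ u ⟧) F
        covering : ∀ x → Any (λ t → x ∈ ⟦ t ⟧) F

    module _ {C* : Clustering n} (C*-cl : IsClustering C*) (stable : Stable S C*) where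

      forest-resp-↭ : ∀ {F G} → F ↭ G → IsForest C* F → IsForest C* G
      forest-resp-↭ F↭G forest = record
        { laminar  = All-resp-↭ F↭G laminar
        ; disjoint = AllPairs-resp-↭ Disjoint-sym F↭G disjoint
        ; covering = λ x → Any-resp-↭ F↭G (covering x)
        }
        where open IsForest forest

      -- Some node inside D ─ ⟦ t ⟧ is at least as similar to t as D ─ ⟦ t ⟧ is on
      -- average, hence by stability strictly more similar than any node outside D.
      maximal-pair-stays-inside : ∀ {t u G} → IsForest C* (t ∷ u ∷ G) →
        All (λ v → average S ⟦ t ⟧ ⟦ v ⟧ ≤ average S ⟦ t ⟧ ⟦ u ⟧) (u ∷ G) →
        ∀ {D} → D ∈ˡ C* → ⟦ t ⟧ ⊆ D → Disjoint ⟦ u ⟧ D → D ⊆ ⟦ t ⟧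
      maximal-pair-stays-inside {t} {u} {G} forest maximal {D} D∈C* t⊆D u∥D with D ⊆? ⟦ t ⟧
      ... | yes D⊆t = D⊆t
      ... | no D⊈t = ⊥-elim contradiction
        where
        open IsForest forest
        M = average S ⟦ t ⟧ ⟦ u ⟧
        R = D ─ ⟦ t ⟧
        t≠∅ = tree-nonempty t
        y₀ = proj₁ (⊈-witness D⊈t)
        y₀∈D = proj₁ (proj₂ (⊈-witness D⊈t))
        y₀∉t = proj₂ (proj₂ (⊈-witness D⊈t))

        inside-R : ∀ {v} → Laminar C* v → Disjoint ⟦ t ⟧ ⟦ v ⟧ → average S ⟦ t ⟧ ⟦ v ⟧ ≤ M →
                   AverageAtMost M ⟦ t ⟧ (R ∩ ⟦ v ⟧)
        inside-R {v} v-lam t∥v le with laminar⇒compatible v-lam D∈C*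
        ... | inj₁ v⊆D = ≡.subst (AverageAtMost M ⟦ t ⟧) (⊆-antisym v⊆ (p∩q⊆q R ⟦ v ⟧)) (average-≤⁺ t≠∅ (tree-nonempty v) le)
          where
          v⊆ : ⟦ v ⟧ ⊆ R ∩ ⟦ v ⟧
          v⊆ x∈v = x∈p∩q⁺ (x∈p∧x∉q⇒x∈p─q (v⊆D x∈v) (λ x∈t → t∥v (meet x∈t x∈v)) , x∈v)
        ... | inj₂ (inj₁ D⊆v) = ⊥-elim (t∥v (let x , x∈t = t≠∅ in meet x∈t (D⊆v (t⊆D x∈t))))
        ... | inj₂ (inj₂ v∥D) = atMost-empty λ (x , x∈) →
          v∥D (meet (p∩q⊆q R ⟦ v ⟧ x∈) (p─q⊆p D ⟦ t ⟧ (p∩q⊆p R ⟦ v ⟧ x∈)))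

        R-average : average S ⟦ t ⟧ R ≤ M
        R-average = average-≤⁻ t≠∅ (y₀ , x∈p∧x∉q⇒x∈p─q y₀∈D y₀∉t)
          (atMost-cover (map ⟦_⟧ (t ∷ u ∷ G)) R (λ {x} _ → Any.map⁺ {f = ⟦_⟧} (covering x)) (AllPairs.map⁺ {f = ⟦_⟧} disjoint)
            (atMost-empty (λ (x , x∈) → x∈p─q⁻ D ⟦ t ⟧ (p∩q⊆p R ⟦ t ⟧ x∈) (p∩q⊆q R ⟦ t ⟧ x∈))
            ∷ All.map⁺ (All.zipWith (λ {v} (lam , t∥v , le) → inside-R {v} lam t∥v le)
                          (All.tail laminar , All.zip (AllPairs.head disjoint , maximal)))))

        outside-D : ∀ {E A} → E ∈ˡ C* → D ≢ E → Nonempty A → A ⊆ E → average S ⟦ t ⟧ A < M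
        outside-D E∈C* D≢E A≠∅ A⊆E = <-≤-trans
          (stable D∈C* E∈C* D≢E ⟦ t ⟧ _ t≠∅ (t⊆D , y₀ , y₀∈D , y₀∉t) A≠∅ A⊆E) R-average

        -- Stability compares with subsets of a single target, but `⟦ u ⟧` may meet several, so it
        -- is cut along the targets. The piece in the target `E` of one chosen point `z` is nonempty
        -- and supplies the strict inequality; for the rest a weak one is enough.
        z = proj₁ (tree-nonempty u)
        z∈u = proj₂ (tree-nonempty u)
        E = proj₁ (clusterOf C*-cl z)
        E∈C* = proj₁ (proj₂ (clusterOf C*-cl z))
        z∈E = proj₂ (proj₂ (clusterOf C*-cl z))

        rest : AverageAtMost M ⟦ t ⟧ (⟦ u ⟧ ─ E)
        rest = atMost-cover C* (⟦ u ⟧ ─ E) (λ {x} _ → IsClustering.covering C*-cl x) (IsClustering.disjoint C*-cl)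
          (All.tabulate λ {E′} E′∈C* → part E′ E′∈C* (nonempty? ((⟦ u ⟧ ─ E) ∩ E′)))
          where
          part : ∀ E′ → E′ ∈ˡ C* → Dec (Nonempty ((⟦ u ⟧ ─ E) ∩ E′)) → AverageAtMost M ⟦ t ⟧ ((⟦ u ⟧ ─ E) ∩ E′)
          part E′ E′∈C* (no empty) = atMost-empty empty
          part E′ E′∈C* (yes (x , x∈)) = average-≤⁺ t≠∅ (x , x∈)
            (proj₁ (outside-D E′∈C*
              (λ { refl → u∥D (meet (p─q⊆p ⟦ u ⟧ E (p∩q⊆p _ E′ x∈)) (p∩q⊆q _ E′ x∈)) })
              (x , x∈) (p∩q⊆q (⟦ u ⟧ ─ E) E′)))

        M< : weight ⟦ t ⟧ ⟦ u ⟧ < M * fromℕ (∣ ⟦ t ⟧ ∣ ℕ.* ∣ ⟦ u ⟧ ∣)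
        M< = begin-strict
          weight ⟦ t ⟧ ⟦ u ⟧                                     ≈⟨ weight-split ⟦ t ⟧ ⟦ u ⟧ E ⟩
          weight ⟦ t ⟧ (⟦ u ⟧ ∩ E) + weight ⟦ t ⟧ (⟦ u ⟧ ─ E)     <⟨ +-mono-<-≤ below-M rest ⟩
          M * fromℕ (∣ ⟦ t ⟧ ∣ ℕ.* ∣ ⟦ u ⟧ ∩ E ∣) + M * fromℕ (∣ ⟦ t ⟧ ∣ ℕ.* ∣ ⟦ u ⟧ ─ E ∣) ≈⟨ sizes-split M ⟦ t ⟧ ⟦ u ⟧ E ⟨
          M * fromℕ (∣ ⟦ t ⟧ ∣ ℕ.* ∣ ⟦ u ⟧ ∣)                     ∎
          where
          uE≠∅ : Nonempty (⟦ u ⟧ ∩ E)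
          uE≠∅ = z , x∈p∩q⁺ (z∈u , z∈E)
          avg< = outside-D E∈C* (λ { refl → u∥D (meet z∈u z∈E) }) uE≠∅ (p∩q⊆q ⟦ u ⟧ E)
          below-M : weight ⟦ t ⟧ (⟦ u ⟧ ∩ E) < M * fromℕ (∣ ⟦ t ⟧ ∣ ℕ.* ∣ ⟦ u ⟧ ∩ E ∣)
          below-M = begin-strict
            weight ⟦ t ⟧ (⟦ u ⟧ ∩ E)                        ≈⟨ x/y*y≈x _ positive ⟨
            average S ⟦ t ⟧ (⟦ u ⟧ ∩ E) * fromℕ (∣ ⟦ t ⟧ ∣ ℕ.* ∣ ⟦ u ⟧ ∩ E ∣) <⟨ *-monoʳ-< positive avg< ⟩
            M * fromℕ (∣ ⟦ t ⟧ ∣ ℕ.* ∣ ⟦ u ⟧ ∩ E ∣)         ∎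
            where positive = 0<∣A∣∣B∣ {⟦ t ⟧} {⟦ u ⟧ ∩ E} t≠∅ uE≠∅

        contradiction = <⇒≱ M< (≤-reflexive (x/y*y≈x _ (0<∣A∣∣B∣ {⟦ t ⟧} {⟦ u ⟧} t≠∅ (tree-nonempty u))))

      step-preserves-forest : Symmetric S → ∀ {F F′} → S ⊢ F ⟶ F′ → IsForest C* F → IsForest C* F′
      step-preserves-forest S-sym {F} (join {t = t} {u} {G} F↭ maximal) forest with forest-resp-↭ F↭ forest
      ... | forest′ = record
        { laminar  = node t-lam u-lam t∥u joined-compatible ∷ G-lam
        ; disjoint = All.zipWith (λ (t∥v , u∥v) m → let x , x∈ , x∈v = unmeet m in
                       [ (λ x∈t → t∥v (meet x∈t x∈v)) , (λ x∈u → u∥v (meet x∈u x∈v)) ]′ (x∈p∪q⁻ ⟦ t ⟧ ⟦ u ⟧ x∈))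
                       (All.tail (AllPairs.head disjoint) , AllPairs.head (AllPairs.tail disjoint))
                     ∷ AllPairs.tail (AllPairs.tail disjoint)
        ; covering = cover ∘ covering
        }
        where
        open IsForest forest′
        t-lam = All.head laminar
        u-lam = All.head (All.tail laminar)
        G-lam = All.tail (All.tail laminar)
        t∥u = All.head (AllPairs.head disjoint)

        maximal′ : AllPairs (λ v w → average S ⟦ v ⟧ ⟦ w ⟧ ≤ average S ⟦ t ⟧ ⟦ u ⟧) (t ∷ u ∷ G)
        maximal′ = AllPairs-resp-↭
          (λ le → ≤-trans (≤-reflexive (average-sym S-sym _ _)) le) F↭ maximal

        cover : ∀ {x} → Any (λ v → x ∈ ⟦ v ⟧) (t ∷ u ∷ G) → Any (λ v → x ∈ ⟦ v ⟧) (node t u ∷ G)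
        cover (here x∈t)         = here (x∈p∪q⁺ (inj₁ x∈t))
        cover (there (here x∈u)) = here (x∈p∪q⁺ (inj₂ x∈u))
        cover (there (there p))  = there p

        -- When it is `u` that lies inside a target, the argument is repeated with the two nodes
        -- exchanged; the symmetry of `S` carries maximality over.
        swapped : IsForest C* (u ∷ t ∷ G)
        swapped = forest-resp-↭ (_↭_.swap t u _↭_.refl) forest′

        maximal-u : All (λ v → average S ⟦ u ⟧ ⟦ v ⟧ ≤ average S ⟦ u ⟧ ⟦ t ⟧) (t ∷ G)
        maximal-u = ≤-refl ∷ All.map (λ le → ≤-trans le (≤-reflexive (average-sym S-sym _ _)))
                                     (AllPairs.head (AllPairs.tail maximal′))

        joined-compatible : ∀ {D} → D ∈ˡ C* → Compatible (⟦ t ⟧ ∪ ⟦ u ⟧) D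
        joined-compatible D∈ with laminar⇒compatible t-lam D∈ | laminar⇒compatible u-lam D∈
        ... | inj₂ (inj₁ D⊆t) | _               = inj₂ (inj₁ (⊆-trans D⊆t (p⊆p∪q ⟦ u ⟧)))
        ... | _               | inj₂ (inj₁ D⊆u) = inj₂ (inj₁ (⊆-trans D⊆u (q⊆p∪q ⟦ t ⟧ ⟦ u ⟧)))
        ... | inj₁ t⊆D        | inj₁ u⊆D        = inj₁ (∪-lub t⊆D u⊆D)
        -- This case and the next are the only ones that use maximality: one node is inside `D` and
        -- the other misses it, which can happen only if the first is already all of `D`.
        ... | inj₁ t⊆D        | inj₂ (inj₂ u∥D) = inj₂ (inj₁ (⊆-trans
          (maximal-pair-stays-inside forest′ (AllPairs.head maximal′) D∈ t⊆D u∥D) (p⊆p∪q ⟦ u ⟧)))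
        ... | inj₂ (inj₂ t∥D) | inj₁ u⊆D        = inj₂ (inj₁ (⊆-trans
          (maximal-pair-stays-inside swapped maximal-u D∈ u⊆D t∥D) (q⊆p∪q ⟦ t ⟧ ⟦ u ⟧)))
        ... | inj₂ (inj₂ t∥D) | inj₂ (inj₂ u∥D) = inj₂ (inj₂ λ m → let x , x∈ , x∈D = unmeet m in
          [ (λ x∈t → t∥D (meet x∈t x∈D)) , (λ x∈u → u∥D (meet x∈u x∈D)) ]′ (x∈p∪q⁻ ⟦ t ⟧ ⟦ u ⟧ x∈))

      initial-forest : IsForest C* (map leaf (allFin n))
      initial-forest = record
        { laminar  = All.map⁺ (All.universal leaf (allFin n))
        ; disjoint = AllPairs.map⁺ (AllPairs.map (λ x≢y m → let z , z∈x , z∈y = unmeet m in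
                       x≢y (≡.trans (≡.sym (x∈⁅y⁆⇒x≡y _ z∈x)) (x∈⁅y⁆⇒x≡y _ z∈y))) (Unique.allFin⁺ n))
        ; covering = λ x → Any.map⁺ (Any.map (λ { refl → x∈⁅x⁆ x }) (∈-allFin x))
        }

      averageLinkage-laminar : Symmetric S → ∀ {T} → IsAverageLinkageTree S T → Laminar C* T × (∀ x → x ∈ ⟦ T ⟧)
      averageLinkage-laminar S-sym steps with preserve steps initial-forest
        where
        preserve : ∀ {F F′} → Star (S ⊢_⟶_) F F′ → IsForest C* F → IsForest C* F′
        preserve ε            forest = forest
        preserve (s ◅ steps′) forest = preserve steps′ (step-preserves-forest S-sym s forest)
      ... | forest = All.head laminar , λ x → Any.singleton⁻ (covering x)
        where open IsForest forest

-- Counting in lists, and the contribution of one target to the potential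

module Combinatorics where
  open import Data.Nat using (_≤_; _<_; _+_; _*_; _∸_; _^_)
  open import Data.Nat.Properties hiding (_≟_)
  open ≡ using (cong; cong₂; sym; trans; subst)

  module _ {a p} {A : Set a} {P : Pred A p} (P? : Decidable P) where
    count : List A → ℕ
    count xs = length (filter P? xs)

    count-++ : ∀ xs ys → count (xs ++ ys) ≡ count xs + count ys
    count-++ xs ys = trans (cong length (filter-++ P? xs ys)) (length-++ (filter P? xs))

    count-↭ : ∀ {xs ys} → xs ↭ ys → count xs ≡ count ys
    count-↭ xs↭ys = ↭-length (filter-↭ P? xs↭ys)

    count-none : ∀ {xs} → All (¬_ ∘ P) xs → count xs ≡ 0
    count-none ¬Ps = cong length (filter-none P? ¬Ps)

    count-all : ∀ {xs} → All P xs → count xs ≡ length xs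
    count-all Ps = cong length (filter-all P? Ps)

    count-some : ∀ {xs} → Any P xs → 1 ≤ count xs
    count-some = filter-some P?

    count-exclusive-pair : ∀ {x y} → ¬ (P x × P y) → count (x ∷ y ∷ []) ≤ 1
    count-exclusive-pair {x} {y} ¬both with P? x
    ... | yes Px = s≤s (≤-reflexive (count-none ((λ Py → ¬both (Px , Py)) ∷ [])))
    ... | no _   = length-filter P? (y ∷ [])

  module _ {a p q} {A : Set a} {P : Pred A p} {Q : Pred A q} (P? : Decidable P) (Q? : Decidable Q) where
    count-mono : ∀ {xs} → All (λ x → P x → Q x) xs → count P? xs ≤ count Q? xs
    count-mono []               = z≤n
    count-mono {x ∷ xs} (P⇒Q ∷ rest) with P? x | Q? x
    ... | yes _  | yes _  = s≤s (count-mono rest)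
    ... | yes Px | no ¬Qx = ⊥-elim (¬Qx (P⇒Q Px))
    ... | no _   | yes _  = m≤n⇒m≤1+n (count-mono rest)
    ... | no _   | no _   = count-mono rest

    count-⊎ : ∀ {r} {R : Pred A r} (R? : Decidable R) {xs} → All (λ x → R x → P x ⊎ Q x) xs →
              count R? xs ≤ count P? xs + count Q? xs
    count-⊎ R? []                       = z≤n
    count-⊎ R? {x ∷ xs} (R⇒P⊎Q ∷ rest) with R? x | P? x | Q? x
    ... | yes _  | yes _  | yes _  = s≤s (≤-trans (count-⊎ R? rest) (+-monoʳ-≤ _ (n≤1+n _)))
    ... | yes _  | yes _  | no _   = s≤s (count-⊎ R? rest)
    ... | yes _  | no _   | yes _  = ≤-trans (s≤s (count-⊎ R? rest)) (≤-reflexive (sym (+-suc _ _)))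
    ... | yes Rx | no ¬Px | no ¬Qx = ⊥-elim ([ ¬Px , ¬Qx ]′ (R⇒P⊎Q Rx))
    ... | no _   | yes _  | yes _  = ≤-trans (count-⊎ R? rest) (+-mono-≤ (n≤1+n _) (n≤1+n _))
    ... | no _   | yes _  | no _   = m≤n⇒m≤1+n (count-⊎ R? rest)
    ... | no _   | no _   | yes _  = ≤-trans (count-⊎ R? rest) (+-monoʳ-≤ _ (n≤1+n _))
    ... | no _   | no _   | no _   = count-⊎ R? rest

    count-disjoint : ∀ {r} {R : Pred A r} (R? : Decidable R) {xs} →
                     All (λ x → ¬ (P x × Q x)) xs → (∀ {x} → P x → R x) → (∀ {x} → Q x → R x) →
                     count P? xs + count Q? xs ≤ count R? xs
    count-disjoint R? []                     P⇒R Q⇒R = z≤n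
    count-disjoint R? {x ∷ xs} (¬both ∷ rest) P⇒R Q⇒R with P? x | Q? x | R? x
    ... | yes Px | yes Qx | _      = ⊥-elim (¬both (Px , Qx))
    ... | yes _  | no _   | yes _  = s≤s (count-disjoint R? rest P⇒R Q⇒R)
    ... | no _   | yes _  | yes _  = ≤-trans (≤-reflexive (+-suc _ _)) (s≤s (count-disjoint R? rest P⇒R Q⇒R))
    ... | no _   | no _   | yes _  = m≤n⇒m≤1+n (count-disjoint R? rest P⇒R Q⇒R)
    ... | yes Px | no _   | no ¬Rx = ⊥-elim (¬Rx (P⇒R Px))
    ... | no _   | yes Qx | no ¬Rx = ⊥-elim (¬Rx (Q⇒R Qx))
    ... | no _   | no _   | no _   = count-disjoint R? rest P⇒R Q⇒R

  -- Contribution to the potential of a target met by p clusters, b of them bad.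
  φ : ℕ → ℕ → ℕ
  φ zero          b = 0
  φ (suc zero)    b = 0
  φ (suc (suc p)) b = 2 * suc p + b

  φ-mono : ∀ {p p′ b b′} → p′ ≤ p → b′ ≤ b → φ p′ b′ ≤ φ p b
  φ-mono {p′ = zero}         _                 _    = z≤n
  φ-mono {p′ = suc zero}     _                 _    = z≤n
  φ-mono {p′ = suc (suc p′)} (s≤s (s≤s p′≤p)) b′≤b = +-mono-≤ (*-monoʳ-≤ 2 (s≤s p′≤p)) b′≤b

  -- One cluster less is worth 2, which pays for one more bad cluster and leaves a gain of 1.
  φ-drop : ∀ {p p′ b b′} → suc p′ ≤ suc (suc p) → b′ ≤ suc b → φ p′ b′ < φ (suc (suc p)) b
  φ-drop {p′ = zero}         _                _ = s≤s z≤n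
  φ-drop {p′ = suc zero}     _                _ = s≤s z≤n
  φ-drop {suc p} {suc (suc p′)} {b} {b′} (s≤s (s≤s p′≤p)) b′≤1+b = begin
    suc (2 * suc p′ + b′)      ≤⟨ s≤s (+-mono-≤ (*-monoʳ-≤ 2 p′≤p) b′≤1+b) ⟩
    suc (2 * suc p + suc b)    ≡⟨ cong suc (+-suc _ b) ⟩
    2 + (2 * suc p + b)        ≡⟨⟩
    2 + 2 * suc p + b          ≡⟨ cong (_+ b) (sym (*-suc 2 (suc p))) ⟩
    2 * suc (suc p) + b        ∎
    where open ≤-Reasoning

  φ-fewer-bad : ∀ {p p′ b b′} → p′ ≤ suc (suc p) → suc b′ ≤ b → φ p′ b′ < φ (suc (suc p)) b
  φ-fewer-bad {p′ = zero}         _                 _    = s≤s z≤n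
  φ-fewer-bad {p′ = suc zero}     _                 _    = s≤s z≤n
  φ-fewer-bad {p} {suc (suc p′)} {b} {b′} (s≤s (s≤s p′≤p)) b′<b = begin
    suc (2 * suc p′ + b′) ≡⟨ sym (+-suc (2 * suc p′) b′) ⟩
    2 * suc p′ + suc b′   ≤⟨ +-mono-≤ (*-monoʳ-≤ 2 (s≤s p′≤p)) b′<b ⟩
    2 * suc p + b         ∎
    where open ≤-Reasoning

  -- Smallest tree nodes and the splits they define

  module _ {n : ℕ} where
    deepest-⊆ : ∀ (t : Tree n) Y → ⟦ deepest t Y ⟧ ⊆ ⟦ t ⟧
    deepest-⊆ (leaf x)   Y = id
    deepest-⊆ (node l r) Y with Y ⊆? ⟦ l ⟧ | Y ⊆? ⟦ r ⟧
    ... | yes _ | _     = ⊆-trans (deepest-⊆ l Y) (p⊆p∪q ⟦ r ⟧)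
    ... | no _  | yes _ = ⊆-trans (deepest-⊆ r Y) (q⊆p∪q ⟦ l ⟧ ⟦ r ⟧)
    ... | no _  | no _  = id

    ⊆-deepest : ∀ (t : Tree n) {Y} → Y ⊆ ⟦ t ⟧ → Y ⊆ ⟦ deepest t Y ⟧
    ⊆-deepest (leaf x)   Y⊆t = Y⊆t
    ⊆-deepest (node l r) {Y} Y⊆t with Y ⊆? ⟦ l ⟧ | Y ⊆? ⟦ r ⟧
    ... | yes Y⊆l | _       = ⊆-deepest l Y⊆l
    ... | no _    | yes Y⊆r = ⊆-deepest r Y⊆r
    ... | no _    | no _    = Y⊆t

    deepest-crosses : ∀ (t : Tree n) Y {l r} → deepest t Y ≡ node l r → ¬ (Y ⊆ ⟦ l ⟧) × ¬ (Y ⊆ ⟦ r ⟧)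
    deepest-crosses (node l r) Y eq with Y ⊆? ⟦ l ⟧ | Y ⊆? ⟦ r ⟧
    ... | yes _   | _       = deepest-crosses l Y eq
    ... | no _    | yes _   = deepest-crosses r Y eq
    deepest-crosses (node l r) Y refl | no Y⊈l | no Y⊈r = Y⊈l , Y⊈r

    Split-node : ∀ (t : Tree n) Y {l r} → deepest t Y ≡ node l r → Split t Y ≡ (Y ∩ ⟦ l ⟧ , Y ∩ ⟦ r ⟧)
    Split-node t Y eq with deepest t Y
    Split-node t Y refl | node l r = refl

    deepest-nodeˡ : ∀ (l r : Tree n) {A} → A ⊆ ⟦ l ⟧ → deepest (node l r) A ≡ deepest l A
    deepest-nodeˡ l r {A} A⊆l with A ⊆? ⟦ l ⟧
    ... | yes _  = refl
    ... | no A⊈l = ⊥-elim (A⊈l A⊆l)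

    deepest-nodeʳ : ∀ (l r : Tree n) {A} → ¬ (A ⊆ ⟦ l ⟧) → A ⊆ ⟦ r ⟧ → deepest (node l r) A ≡ deepest r A
    deepest-nodeʳ l r {A} A⊈l A⊆r with A ⊆? ⟦ l ⟧ | A ⊆? ⟦ r ⟧
    ... | yes A⊆l | _      = ⊥-elim (A⊈l A⊆l)
    ... | no _    | yes _  = refl
    ... | no _    | no A⊈r = ⊥-elim (A⊈r A⊆r)

    deepest-node : ∀ (l r : Tree n) {A} → ¬ (A ⊆ ⟦ l ⟧) → ¬ (A ⊆ ⟦ r ⟧) → deepest (node l r) A ≡ node l r
    deepest-node l r {A} A⊈l A⊈r with A ⊆? ⟦ l ⟧ | A ⊆? ⟦ r ⟧
    ... | yes A⊆l | _       = ⊥-elim (A⊈l A⊆l)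
    ... | no _    | yes A⊆r = ⊥-elim (A⊈r A⊆r)
    ... | no _    | no _    = refl

    ⊆-disjoint⇒⊈ : ∀ {A L R : Subset n} → Nonempty A → A ⊆ R → Disjoint L R → ¬ (A ⊆ L)
    ⊆-disjoint⇒⊈ (x , x∈A) A⊆R L∥R A⊆L = L∥R (meet (A⊆L x∈A) (A⊆R x∈A))

  module _ {n} {C* : Clustering n} where
    deepest-laminar : ∀ {t} → Laminar C* t → ∀ Y → Laminar C* (deepest t Y)
    deepest-laminar (leaf x) Y = leaf x
    deepest-laminar {node l r} t-lam@(node l-lam r-lam _ _) Y with Y ⊆? ⟦ l ⟧ | Y ⊆? ⟦ r ⟧
    ... | yes _ | _     = deepest-laminar l-lam Y
    ... | no _  | yes _ = deepest-laminar r-lam Y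
    ... | no _  | no _  = t-lam

    -- The search for `A` follows the search for `Y` until the latter stops. The left child is tried
    -- first, so `A` could stray to the left where `Y` goes right; a point of `A` and the
    -- disjointness of the children exclude this.
    deepest-nested : ∀ {t} → Laminar C* t → ∀ {A Y} → Nonempty A → A ⊆ Y →
                     deepest t A ≡ deepest (deepest t Y) A
    deepest-nested (leaf x) _ _ = refl
    deepest-nested {node l r} (node l-lam r-lam l∥r _) {A} {Y} A≠∅ A⊆Y with Y ⊆? ⟦ l ⟧ | Y ⊆? ⟦ r ⟧
    ... | yes Y⊆l | _       = trans (deepest-nodeˡ l r (⊆-trans A⊆Y Y⊆l)) (deepest-nested l-lam A≠∅ A⊆Y)
    ... | no _    | yes Y⊆r = trans
      (deepest-nodeʳ l r (⊆-disjoint⇒⊈ A≠∅ (⊆-trans A⊆Y Y⊆r) l∥r) (⊆-trans A⊆Y Y⊆r)) (deepest-nested r-lam A≠∅ A⊆Y)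
    ... | no _    | no _    = refl

  module LaminarTree {n} {T : Tree n} {C* : Clustering n} (C*-cl : IsClustering C*)
                     (T-lam : Laminar C* T) (T-all : ∀ x → x ∈ ⟦ T ⟧) where

    -- Two distinct points of `Y` exclude the leaf case of `Split`. The view keeps what remains, and
    -- `split≡` lets `Split` be rewritten away.
    record SplitView (Y : Subset n) : Set where
      constructor splitView
      field
        {l r}     : Tree n
        deepest≡  : deepest T Y ≡ node l r
        split≡    : Split T Y ≡ (Y ∩ ⟦ l ⟧ , Y ∩ ⟦ r ⟧)
        Y⊈l       : ¬ (Y ⊆ ⟦ l ⟧)
        Y⊈r       : ¬ (Y ⊆ ⟦ r ⟧)
        Y⊆l∪r     : Y ⊆ ⟦ l ⟧ ∪ ⟦ r ⟧
        laminar   : Laminar C* (node l r)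

      N Yˡ Yʳ : Subset n
      N  = ⟦ l ⟧ ∪ ⟦ r ⟧
      Yˡ = Y ∩ ⟦ l ⟧
      Yʳ = Y ∩ ⟦ r ⟧

      l∥r : Disjoint ⟦ l ⟧ ⟦ r ⟧
      l∥r with node _ _ l∥r _ ← laminar = l∥r

      l-laminar : Laminar C* l
      l-laminar with node l-lam _ _ _ ← laminar = l-lam

      r-laminar : Laminar C* r
      r-laminar with node _ r-lam _ _ ← laminar = r-lam

      Yˡ≠∅ : Nonempty Yˡ
      Yˡ≠∅ with x , x∈Y , x∉r ← ⊈-witness Y⊈r = x , x∈p∩q⁺ (x∈Y , [ id , (λ x∈r → ⊥-elim (x∉r x∈r)) ]′ (x∈p∪q⁻ ⟦ l ⟧ ⟦ r ⟧ (Y⊆l∪r x∈Y)))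

      Yʳ≠∅ : Nonempty Yʳ
      Yʳ≠∅ with x , x∈Y , x∉l ← ⊈-witness Y⊈l = x , x∈p∩q⁺ (x∈Y , [ (λ x∈l → ⊥-elim (x∉l x∈l)) , id ]′ (x∈p∪q⁻ ⟦ l ⟧ ⟦ r ⟧ (Y⊆l∪r x∈Y)))

      Yˡ∥Yʳ : Disjoint Yˡ Yʳ
      Yˡ∥Yʳ = l∥r ∘ Meets-mono (p∩q⊆q Y ⟦ l ⟧) (p∩q⊆q Y ⟦ r ⟧)

      parts⁺ : ∀ {x} → x ∈ Y → x ∈ Yˡ ⊎ x ∈ Yʳ
      parts⁺ x∈Y with x∈p∪q⁻ ⟦ l ⟧ ⟦ r ⟧ (Y⊆l∪r x∈Y)
      ... | inj₁ x∈l = inj₁ (x∈p∩q⁺ (x∈Y , x∈l))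
      ... | inj₂ x∈r = inj₂ (x∈p∩q⁺ (x∈Y , x∈r))

    view : ∀ {Y x y} → x ∈ Y → y ∈ Y → x ≢ y → SplitView Y
    view {Y} {x} {y} x∈Y y∈Y x≢y with deepest T Y in eq
    ... | leaf z = ⊥-elim (x≢y (trans (singleton x∈Y) (sym (singleton y∈Y))))
      where
      singleton : ∀ {w} → w ∈ Y → w ≡ z
      singleton w∈Y = x∈⁅y⁆⇒x≡y z (subst (λ t → _ ∈ ⟦ t ⟧) eq (⊆-deepest T (λ {v} _ → T-all v) w∈Y))
    ... | node l r = splitView eq (Split-node T Y eq) (proj₁ crosses) (proj₂ crosses)
        (subst (λ t → Y ⊆ ⟦ t ⟧) eq (⊆-deepest T (λ {v} _ → T-all v)))
        (subst (Laminar C*) eq (deepest-laminar T-lam Y))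
      where
      crosses = deepest-crosses T Y eq
    hull : Subset n → Subset n
    hull A = ⟦ deepest T A ⟧

    ⊆-hull : ∀ {A} → A ⊆ hull A
    ⊆-hull = ⊆-deepest T (λ {v} _ → T-all v)

    hull-compatible : ∀ A {D} → D ∈ˡ C* → Compatible (hull A) D
    hull-compatible A = laminar⇒compatible (deepest-laminar T-lam A)

    -- A cluster meeting D is bad if it is impure or straddles the two children of the tree node D.
    Bad : Subset n → Subset n → Set
    Bad D A = Meets D A × D ⊆ hull A

    bad? : ∀ D A → Dec (Bad D A)
    bad? D A = meets? D A ×-dec (D ⊆? hull A)

    -- By laminarity the smallest node around a cluster meeting `D` either contains `D`, which is
    -- badness, or lies inside `D`. This is why badness can be read off the hull alone.
    ¬bad⇒⊆ : ∀ {D A} → D ∈ˡ C* → Meets D A → ¬ Bad D A → A ⊆ D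
    ¬bad⇒⊆ {D} {A} D∈ D∩A ¬bad with hull-compatible A D∈
    ... | inj₁ hull⊆D        = ⊆-trans ⊆-hull hull⊆D
    ... | inj₂ (inj₁ D⊆hull) = ⊥-elim (¬bad (D∩A , D⊆hull))
    ... | inj₂ (inj₂ hull∥D) = ⊥-elim (hull∥D (Meets-sym (Meets-mono id ⊆-hull D∩A)))

    module _ {Y} (V : SplitView Y) where
      open SplitView V

      hull≡N : hull Y ≡ N
      hull≡N = cong ⟦_⟧ deepest≡

      deepest-within : ∀ {A} → Nonempty A → A ⊆ Y → deepest T A ≡ deepest (node l r) A
      deepest-within A≠∅ A⊆Y = trans (deepest-nested T-lam A≠∅ A⊆Y) (cong (λ t → deepest t _) deepest≡)

      hull-left : ∀ {A} → Nonempty A → A ⊆ Y → A ⊆ ⟦ l ⟧ → hull A ⊆ ⟦ l ⟧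
      hull-left A≠∅ A⊆Y A⊆l = subst (λ t → ⟦ t ⟧ ⊆ ⟦ l ⟧)
        (sym (trans (deepest-within A≠∅ A⊆Y) (deepest-nodeˡ l r A⊆l))) (deepest-⊆ l _)

      hull-right : ∀ {A} → Nonempty A → A ⊆ Y → A ⊆ ⟦ r ⟧ → hull A ⊆ ⟦ r ⟧
      hull-right A≠∅ A⊆Y A⊆r = subst (λ t → ⟦ t ⟧ ⊆ ⟦ r ⟧)
        (sym (trans (deepest-within A≠∅ A⊆Y) (deepest-nodeʳ l r (⊆-disjoint⇒⊈ A≠∅ A⊆r l∥r) A⊆r))) (deepest-⊆ r _)

      ¬N⊆l : ¬ (N ⊆ ⟦ l ⟧)
      ¬N⊆l N⊆l = let x , x∈r = tree-nonempty r in l∥r (meet (N⊆l (q⊆p∪q ⟦ l ⟧ ⟦ r ⟧ x∈r)) x∈r)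

      ¬N⊆r : ¬ (N ⊆ ⟦ r ⟧)
      ¬N⊆r N⊆r = let x , x∈l = tree-nonempty l in l∥r (meet x∈l (N⊆r (p⊆p∪q ⟦ r ⟧ x∈l)))

      -- Such an `E` lies inside `N`. Compatible with both children but within neither, it would
      -- contain both and hence `N`.
      clean : ∀ {E} → E ∈ˡ C* → Meets E N → ¬ (N ⊆ E) → E ⊆ ⟦ l ⟧ ⊎ E ⊆ ⟦ r ⟧
      clean {E} E∈ E∩N N⊈E
        with laminar⇒compatible laminar E∈ | laminar⇒compatible l-laminar E∈ | laminar⇒compatible r-laminar E∈
      ... | inj₁ N⊆E        | _               | _               = ⊥-elim (N⊈E N⊆E)
      ... | inj₂ (inj₂ N∥E) | _               | _               = ⊥-elim (N∥E (Meets-sym E∩N))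
      ... | inj₂ (inj₁ _)   | inj₂ (inj₁ E⊆l) | _               = inj₁ E⊆l
      ... | inj₂ (inj₁ _)   | _               | inj₂ (inj₁ E⊆r) = inj₂ E⊆r
      ... | inj₂ (inj₁ _)   | inj₁ l⊆E        | inj₁ r⊆E        = ⊥-elim (N⊈E (∪-lub l⊆E r⊆E))
      ... | inj₂ (inj₁ E⊆N) | inj₁ _          | inj₂ (inj₂ r∥E) = inj₁ λ x∈E →
        [ id , (λ x∈r → ⊥-elim (r∥E (meet x∈r x∈E))) ]′ (x∈p∪q⁻ ⟦ l ⟧ ⟦ r ⟧ (E⊆N x∈E))
      ... | inj₂ (inj₁ E⊆N) | inj₂ (inj₂ l∥E) | _               = inj₂ λ x∈E →
        [ (λ x∈l → ⊥-elim (l∥E (meet x∈l x∈E))) , id ]′ (x∈p∪q⁻ ⟦ l ⟧ ⟦ r ⟧ (E⊆N x∈E))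

      -- A target containing `N` would meet `D`, hence be `D`.
      impure-hull : ∀ {D} → D ∈ˡ C* → Meets D N → ¬ (N ⊆ D) → ∀ {E} → E ∈ˡ C* → ¬ (N ⊆ E)
      impure-hull {D} D∈ D∩N N⊈D {E} E∈ N⊆E =
        N⊈D (subst (N ⊆_) (meets⇒≡ C*-cl E∈ D∈ (Meets-sym (Meets-mono id N⊆E D∩N))) N⊆E)

      clean-parts : (∀ {E} → E ∈ˡ C* → ¬ (N ⊆ E)) → ∀ {E} → E ∈ˡ C* → ¬ (Meets E Yˡ × Meets E Yʳ)
      clean-parts impure E∈ (E∩Yˡ , E∩Yʳ) with clean E∈ (Meets-mono id (⊆-trans (p∩q⊆p Y ⟦ l ⟧) Y⊆l∪r) E∩Yˡ) (impure E∈)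
      ... | inj₁ E⊆l = l∥r (Meets-mono E⊆l (p∩q⊆q Y ⟦ r ⟧) E∩Yʳ)
      ... | inj₂ E⊆r = l∥r (Meets-sym (Meets-mono E⊆r (p∩q⊆q Y ⟦ l ⟧) E∩Yˡ))

  -- The local effect of a split or merge request

  module Replacements {n} {T : Tree n} {C* C₀ : Clustering n} (C*-cl : IsClustering C*)
                      (T-lam : Laminar C* T) (T-all : ∀ x → x ∈ ⟦ T ⟧) where
    open LaminarTree C*-cl T-lam T-all
    open Interaction T C* C₀

    hits bads : Subset n → Clustering n → ℕ
    hits D = count (meets? D)
    bads D = count (bad? D)

    spread : Subset n → ℕ
    spread A = count (meets? A) C*

    overclustering : Clustering n → ℕ
    overclustering C = sum (map (λ A → spread A ∸ 1) C)

    bads≤hits : ∀ D C → bads D C ≤ hits D C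
    bads≤hits D C = count-mono (bad? D) (meets? D) (All.universal (λ _ → proj₁) C)

    -- `q` and `s` stand for the hits and bad clusters among the clusters that the request leaves
    -- alone. As `φ` is cut off at `p ≤ 1`, it is not additive, and the comparison has to hold in
    -- every such context.
    NonIncreasing Decreasing : Clustering n → Clustering n → Subset n → Set
    NonIncreasing Old New D = ∀ q s → φ (hits D New + q) (bads D New + s) ≤ φ (hits D Old + q) (bads D Old + s)
    Decreasing    Old New D = ∀ q s → φ (hits D New + q) (bads D New + s) < φ (hits D Old + q) (bads D Old + s)

    -- `hits-≤` is demanded besides `nonIncreasing` because the chance of progress at a later
    -- clustering depends on the underclustering error there, which must never exceed `δᵤ`.
    record Replacement (Old New : Clustering n) : Set where
      field
        nonempty      : All Nonempty New
        disjoint      : AllPairs Disjoint New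
        covered⁺      : ∀ {x} → Any (x ∈_) Old → Any (x ∈_) New
        covered⁻      : ∀ {x} → Any (x ∈_) New → Any (x ∈_) Old
        hits-≤        : ∀ {E} → E ∈ˡ C* → hits E New ≤ hits E Old
        nonIncreasing : ∀ {E} → E ∈ˡ C* → NonIncreasing Old New E

    nonIncreasing-≤ : ∀ {Old New E} → hits E New ≤ hits E Old → bads E New ≤ bads E Old → NonIncreasing Old New E
    nonIncreasing-≤ h b q s = φ-mono (+-monoˡ-≤ q h) (+-monoˡ-≤ s b)

    1≤spread : ∀ {A} → Nonempty A → 1 ≤ spread A
    1≤spread {A} (x , x∈A) = count-some (meets? A) (Any.map (meet x∈A) (IsClustering.covering C*-cl x))

    spread-pure : ∀ {A D} → D ∈ˡ C* → A ⊆ D → spread A ≤ 1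
    spread-pure {A} {D} D∈ A⊆D = ≤-trans
      (count-mono (meets? A) (D ≟_) (All.tabulate λ E∈ A∩E → meets⇒≡ C*-cl D∈ E∈ (Meets-mono A⊆D id A∩E)))
      (at-most-once (IsClustering.nonempty C*-cl) (IsClustering.disjoint C*-cl))
      where
      at-most-once : ∀ {C} → All Nonempty C → AllPairs Disjoint C → count (D ≟_) C ≤ 1
      at-most-once [] [] = z≤n
      at-most-once {E ∷ C} ((x , x∈E) ∷ ne) (E∥C ∷ dis) with D ≟ E
      ... | yes refl = s≤s (≤-reflexive (count-none (D ≟_) (All.map (λ { D∥D refl → D∥D (meet x∈E x∈E) }) E∥C)))
      ... | no _     = at-most-once ne dis

    module Parts {Y} (V : SplitView Y) where
      open SplitView V public

      parts : Clustering n
      parts = Yˡ ∷ Yʳ ∷ []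

      parts-nonempty : All Nonempty parts
      parts-nonempty = Yˡ≠∅ ∷ Yʳ≠∅ ∷ []

      parts-disjoint : AllPairs Disjoint parts
      parts-disjoint = (Yˡ∥Yʳ ∷ []) ∷ [] ∷ []

      parts-covered⁺ : ∀ {x} → x ∈ Y → Any (x ∈_) parts
      parts-covered⁺ x∈Y with parts⁺ x∈Y
      ... | inj₁ x∈ = here x∈
      ... | inj₂ x∈ = there (here x∈)

      parts-covered⁻ : ∀ {x} → Any (x ∈_) parts → x ∈ Y
      parts-covered⁻ (here x∈)         = p∩q⊆p Y ⟦ l ⟧ x∈
      parts-covered⁻ (there (here x∈)) = p∩q⊆p Y ⟦ r ⟧ x∈

      hits-parts-none : ∀ {E} → ¬ Meets E Y → hits E parts ≡ 0
      hits-parts-none {E} E∥Y = count-none (meets? E)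
        ((E∥Y ∘ Meets-mono id (p∩q⊆p Y ⟦ l ⟧)) ∷ (E∥Y ∘ Meets-mono id (p∩q⊆p Y ⟦ r ⟧)) ∷ [])

      module Clean (impure : ∀ {E} → E ∈ˡ C* → ¬ (N ⊆ E)) where
        hits-parts : ∀ {E} → E ∈ˡ C* → hits E parts ≤ 1
        hits-parts {E} E∈ = count-exclusive-pair (meets? E) (clean-parts V impure E∈)

        hits-parts-≤ : ∀ {E Old} → E ∈ˡ C* → (∀ {x} → x ∈ Y → Any (x ∈_) Old) → hits E parts ≤ hits E Old
        hits-parts-≤ {E} E∈ Y⊆Old with meets? E Y
        ... | no E∥Y  = ≤-trans (≤-reflexive (hits-parts-none E∥Y)) z≤n
        ... | yes E∩Y with x , x∈E , x∈Y ← unmeet E∩Y =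
          ≤-trans (hits-parts E∈) (count-some (meets? E) (Any.map (meet x∈E) (Y⊆Old x∈Y)))

        bads-parts-≤ : ∀ {E Old} → E ∈ˡ C* → (Meets E Y → Any (Bad E) Old) → bads E parts ≤ bads E Old
        bads-parts-≤ {E} E∈ bad with meets? E Y
        ... | no E∥Y  = ≤-trans (bads≤hits E parts) (≤-trans (≤-reflexive (hits-parts-none E∥Y)) z≤n)
        ... | yes E∩Y = ≤-trans (bads≤hits E parts) (≤-trans (hits-parts E∈) (count-some (bad? E) (bad E∩Y)))

        spread-parts : spread Yˡ + spread Yʳ ≤ spread Y
        spread-parts = count-disjoint (meets? Yˡ) (meets? Yʳ) (meets? Y)
          (All.tabulate λ E∈ (Yˡ∩E , Yʳ∩E) → clean-parts V impure E∈ (Meets-sym Yˡ∩E , Meets-sym Yʳ∩E))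
          (Meets-mono (p∩q⊆p Y ⟦ l ⟧) id) (Meets-mono (p∩q⊆p Y ⟦ r ⟧) id)

        -- Each part meets some target, so the truncated subtractions can be undone. The 2 stands
        -- for the two parts: set against one old cluster it yields a drop of 1, set against two it
        -- yields no growth.
        2+overclustering-parts : 2 + overclustering parts ≤ spread Y
        2+overclustering-parts = begin
          2 + (spread Yˡ ∸ 1 + (spread Yʳ ∸ 1 + 0))      ≡⟨ cong (λ m → 2 + (spread Yˡ ∸ 1 + m)) (+-identityʳ _) ⟩
          2 + (spread Yˡ ∸ 1 + (spread Yʳ ∸ 1))          ≡⟨ cong suc (sym (+-suc (spread Yˡ ∸ 1) _)) ⟩
          suc (spread Yˡ ∸ 1) + suc (spread Yʳ ∸ 1)      ≡⟨ cong₂ _+_ (m+[n∸m]≡n (1≤spread Yˡ≠∅)) (m+[n∸m]≡n (1≤spread Yʳ≠∅)) ⟩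
          spread Yˡ + spread Yʳ                          ≤⟨ spread-parts ⟩
          spread Y                                       ∎
          where open ≤-Reasoning

    module SplitStep {A D D′} (D∈ : D ∈ˡ C*) (D′∈ : D′ ∈ˡ C*) (D≢D′ : D ≢ D′)
                     (A∩D : Meets A D) (A∩D′ : Meets A D′) where
      V : SplitView A
      V with x , x∈A , x∈D ← unmeet A∩D | y , y∈A , y∈D′ ← unmeet A∩D′ =
        view x∈A y∈A λ { refl → distinct⇒disjoint C*-cl D∈ D′∈ D≢D′ (meet x∈D y∈D′) }

      open Parts V

      impure : ∀ {E} → E ∈ˡ C* → ¬ (N ⊆ E)
      impure {E} E∈ N⊆E = D≢D′ (trans (sym (within D∈ A∩D)) (within D′∈ A∩D′))
        where
        within : ∀ {F} → F ∈ˡ C* → Meets A F → E ≡ F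
        within F∈ A∩F = meets⇒≡ C*-cl E∈ F∈ (Meets-mono (⊆-trans Y⊆l∪r N⊆E) id A∩F)

      open Clean impure

      -- The hull lies in no target, so by laminarity it contains every target that `A` meets. The
      -- badness of `A` pays for the one part that still meets `E` and may be bad.
      A-bad : ∀ {E} → E ∈ˡ C* → Meets E A → Bad E A
      A-bad {E} E∈ E∩A with bad? E A
      ... | yes bad = bad
      ... | no ¬bad with hull-compatible A E∈
      ...   | inj₁ hull⊆E        = ⊥-elim (impure E∈ (subst (_⊆ E) (hull≡N V) hull⊆E))
      ...   | inj₂ (inj₁ E⊆hull) = E∩A , E⊆hull
      ...   | inj₂ (inj₂ hull∥E) = ⊥-elim (hull∥E (Meets-sym (Meets-mono id ⊆-hull E∩A)))

      replacement : Replacement [ A ] parts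
      replacement = record
        { nonempty      = parts-nonempty
        ; disjoint      = parts-disjoint
        ; covered⁺      = λ { (here x∈A) → parts-covered⁺ x∈A }
        ; covered⁻      = here ∘ parts-covered⁻
        ; hits-≤        = λ E∈ → hits-parts-≤ E∈ here
        ; nonIncreasing = λ {E} E∈ → nonIncreasing-≤ {[ A ]} {parts} {E} (hits-parts-≤ E∈ here) (bads-parts-≤ E∈ (here ∘ A-bad E∈))
        }

      overclustering-< : overclustering parts < overclustering [ A ]
      overclustering-< = begin
        suc (overclustering parts)        ≤⟨ ∸-monoˡ-≤ 1 2+overclustering-parts ⟩
        spread A ∸ 1                      ≡⟨ +-identityʳ _ ⟨
        overclustering [ A ]              ∎
        where open ≤-Reasoning

    -- By laminarity the smallest node around a target is the target itself, so `l` and `r` are the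
    -- children of the node `D`.
    record Separates (D A B : Subset n) : Set where
      constructor separates
      field
        V    : SplitView D
        A⊆D  : A ⊆ D
        B⊆D  : B ⊆ D
        A⊆l  : A ⊆ ⟦ SplitView.l V ⟧
        B⊆r  : B ⊆ ⟦ SplitView.r V ⟧

    Favourable : Subset n → Subset n → Subset n → Set
    Favourable D A B = (Bad D A ⊎ Bad D B) ⊎ (Separates D A B ⊎ Separates D B A)

    module MergeStep {A B D} (A∥B : Disjoint A B) (D∈ : D ∈ˡ C*) (D∩A : Meets D A) (D∩B : Meets D B) where
      Y : Subset n
      Y = A ∪ B

      A⊆Y : A ⊆ Y
      A⊆Y = p⊆p∪q B

      B⊆Y : B ⊆ Y
      B⊆Y = q⊆p∪q A B

      V : SplitView Y
      V with x , _ , x∈A ← unmeet D∩A | y , _ , y∈B ← unmeet D∩B =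
        view (A⊆Y x∈A) (B⊆Y y∈B) λ { refl → A∥B (meet x∈A y∈B) }

      open Parts V

      Old : Clustering n
      Old = A ∷ B ∷ []

      Same : Set
      Same = Yˡ ≡ A × Yʳ ≡ B ⊎ Yˡ ≡ B × Yʳ ≡ A

      Old-covers : ∀ {x} → x ∈ Y → Any (x ∈_) Old
      Old-covers x∈Y with x∈p∪q⁻ A B x∈Y
      ... | inj₁ x∈A = here x∈A
      ... | inj₂ x∈B = there (here x∈B)

      Old-covered : ∀ {x} → Any (x ∈_) Old → x ∈ Y
      Old-covered (here x∈A)         = A⊆Y x∈A
      Old-covered (there (here x∈B)) = B⊆Y x∈B

      hits-Old : hits D Old ≡ 2
      hits-Old = count-all (meets? D) (D∩A ∷ D∩B ∷ [])

      D∩N : Meets D N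
      D∩N = Meets-mono id (⊆-trans A⊆Y Y⊆l∪r) D∩A

      decreasing-hits : ∀ {New} → hits D New ≤ 1 → Decreasing Old New D
      decreasing-hits {New} h q s rewrite hits-Old =
        φ-drop {q} {hits D New + q} {bads D Old + s} {bads D New + s} (+-monoˡ-≤ q (s≤s h))
          (≤-trans (+-monoˡ-≤ s (≤-trans (bads≤hits D New) h)) (s≤s (m≤n+m s (bads D Old))))

      -- Otherwise the split would cut no target, yet `D` meets both parts, which are `A` and `B`.
      -- Hence two clusters are joined only if both lie in one target.
      same⇒inside : Same → N ⊆ D
      same⇒inside same with N ⊆? D
      ... | yes N⊆D = N⊆D
      ... | no N⊈D  = ⊥-elim (clean-parts V (impure-hull V D∈ D∩N N⊈D) D∈ (both same))
        where
        both : Same → Meets D Yˡ × Meets D Yʳ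
        both (inj₁ (Yˡ≡ , Yʳ≡)) = subst (Meets D) (sym Yˡ≡) D∩A , subst (Meets D) (sym Yʳ≡) D∩B
        both (inj₂ (Yˡ≡ , Yʳ≡)) = subst (Meets D) (sym Yˡ≡) D∩B , subst (Meets D) (sym Yʳ≡) D∩A

      -- The union lies in `D` but in neither child of the node `D`, so it is split at that very
      -- node, which returns the two sets.
      separates⇒same : ∀ {A′ B′} → A′ ∪ B′ ≡ Y → Separates D A′ B′ → Nonempty A′ → Nonempty B′ → Yˡ ≡ A′ × Yʳ ≡ B′
      separates⇒same {A′} {B′} A′∪B′≡Y (separates Vᴰ A′⊆D B′⊆D A′⊆l B′⊆r) A′≠∅ B′≠∅ =
        trans (cong (λ t → Y ∩ ⟦ t ⟧) (left node≡)) (trans (cong (_∩ _) (sym A′∪B′≡Y)) (⊆-antisym inˡ inˡ′)) ,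
        trans (cong (λ t → Y ∩ ⟦ t ⟧) (right node≡)) (trans (cong (_∩ _) (sym A′∪B′≡Y)) (⊆-antisym inʳ inʳ′))
        where
        module VD = SplitView Vᴰ
        A′⊆Y : A′ ⊆ Y
        A′⊆Y = subst (A′ ⊆_) A′∪B′≡Y (p⊆p∪q B′)
        B′⊆Y : B′ ⊆ Y
        B′⊆Y = subst (B′ ⊆_) A′∪B′≡Y (q⊆p∪q A′ B′)
        Y⊆D : Y ⊆ D
        Y⊆D = subst (_⊆ D) A′∪B′≡Y (∪-lub A′⊆D B′⊆D)
        Y-right : ¬ (Y ⊆ ⟦ VD.l ⟧)
        Y-right Y⊆l = ⊆-disjoint⇒⊈ B′≠∅ B′⊆r VD.l∥r (⊆-trans B′⊆Y Y⊆l)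
        Y-left : ¬ (Y ⊆ ⟦ VD.r ⟧)
        Y-left Y⊆r = ⊆-disjoint⇒⊈ A′≠∅ A′⊆l (Disjoint-sym VD.l∥r) (⊆-trans A′⊆Y Y⊆r)
        node≡ : node l r ≡ node VD.l VD.r
        node≡ = trans (sym deepest≡) (trans (deepest-within Vᴰ (proj₁ A′≠∅ , A′⊆Y (proj₂ A′≠∅)) Y⊆D)
          (deepest-node VD.l VD.r Y-right Y-left))
        left : ∀ {l l′ r r′ : Tree n} → node l r ≡ node l′ r′ → l ≡ l′
        left refl = refl
        right : ∀ {l l′ r r′ : Tree n} → node l r ≡ node l′ r′ → r ≡ r′
        right refl = refl
        inˡ : (A′ ∪ B′) ∩ ⟦ VD.l ⟧ ⊆ A′
        inˡ x∈ with x∈Y , x∈l ← x∈p∩q⁻ (A′ ∪ B′) _ x∈ =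
          [ id , (λ x∈B′ → ⊥-elim (VD.l∥r (meet x∈l (B′⊆r x∈B′)))) ]′ (x∈p∪q⁻ A′ B′ x∈Y)
        inˡ′ : A′ ⊆ (A′ ∪ B′) ∩ ⟦ VD.l ⟧
        inˡ′ x∈ = x∈p∩q⁺ (p⊆p∪q B′ x∈ , A′⊆l x∈)
        inʳ : (A′ ∪ B′) ∩ ⟦ VD.r ⟧ ⊆ B′
        inʳ x∈ with x∈Y , x∈r ← x∈p∩q⁻ (A′ ∪ B′) _ x∈ =
          [ (λ x∈A′ → ⊥-elim (VD.l∥r (meet (A′⊆l x∈A′) x∈r))) , id ]′ (x∈p∪q⁻ A′ B′ x∈Y)
        inʳ′ : B′ ⊆ (A′ ∪ B′) ∩ ⟦ VD.r ⟧
        inʳ′ x∈ = x∈p∩q⁺ (q⊆p∪q A′ B′ x∈ , B′⊆r x∈)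

      A≠∅ : Nonempty A
      A≠∅ = let x , _ , x∈A = unmeet D∩A in x , x∈A

      B≠∅ : Nonempty B
      B≠∅ = let x , _ , x∈B = unmeet D∩B in x , x∈B

      separated⇒same : Separates D A B ⊎ Separates D B A → Same
      separated⇒same (inj₁ sep) = inj₁ (separates⇒same refl sep A≠∅ B≠∅)
      separated⇒same (inj₂ sep) = inj₂ (separates⇒same (∪-comm B A) sep B≠∅ A≠∅)

      merged-hits : ∀ E → hits E [ Y ] ≤ hits E Old
      merged-hits E with meets? E Y
      ... | no E∥Y  = z≤n
      ... | yes E∩Y with x , x∈E , x∈Y ← unmeet E∩Y = count-some (meets? E) (Any.map (meet x∈E) (Old-covers x∈Y))

      other-target : N ⊆ D → ∀ {E} → E ∈ˡ C* → E ≢ D → ¬ Meets E Y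
      other-target N⊆D E∈ E≢D E∩Y = E≢D (meets⇒≡ C*-cl E∈ D∈ (Meets-mono id (⊆-trans Y⊆l∪r N⊆D) E∩Y))

      merged-decreasing : Decreasing Old [ Y ] D
      merged-decreasing = decreasing-hits {[ Y ]} (length-filter (meets? D) [ Y ])

      merged-replacement : Same → Replacement Old [ Y ]
      merged-replacement same = record
        { nonempty      = (proj₁ A≠∅ , A⊆Y (proj₂ A≠∅)) ∷ []
        ; disjoint      = [] ∷ []
        ; covered⁺      = here ∘ Old-covered
        ; covered⁻      = λ { (here x∈Y) → Old-covers x∈Y }
        ; hits-≤        = λ {E} _ → merged-hits E
        ; nonIncreasing = nonInc
        }
        where
        nonInc : ∀ {E} → E ∈ˡ C* → NonIncreasing Old [ Y ] E
        nonInc {E} E∈ q s with E ≟ D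
        ... | yes refl = <⇒≤ (merged-decreasing q s)
        ... | no E≢D   = nonIncreasing-≤ {Old} {[ Y ]} {E} (merged-hits E)
          (≤-trans (bads≤hits E [ Y ])
            (≤-trans (≤-reflexive (count-none (meets? E) (other-target (same⇒inside same) E∈ E≢D ∷ []))) z≤n)) q s

      merged-overclustering : Same → overclustering [ Y ] ≤ overclustering Old
      merged-overclustering same = ≤-trans (≤-reflexive (cong (_+ 0)
        (m≤n⇒m∸n≡0 (spread-pure D∈ (⊆-trans Y⊆l∪r (same⇒inside same)))))) z≤n

      -- Each part lies below one child of `N`, so its hull is too small to contain `D`, which
      -- contains `N`.
      resplit-inside-bads : N ⊆ D → bads D parts ≡ 0
      resplit-inside-bads N⊆D = count-none (bad? D)
        ( (λ (_ , D⊆hull) → ¬N⊆l V (⊆-trans N⊆D (⊆-trans D⊆hull (hull-left V Yˡ≠∅ (p∩q⊆p Y ⟦ l ⟧) (p∩q⊆q Y ⟦ l ⟧)))))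
        ∷ (λ (_ , D⊆hull) → ¬N⊆r V (⊆-trans N⊆D (⊆-trans D⊆hull (hull-right V Yʳ≠∅ (p∩q⊆p Y ⟦ r ⟧) (p∩q⊆q Y ⟦ r ⟧)))))
        ∷ [])

      resplit-inside-hits : N ⊆ D → ∀ {E} → E ∈ˡ C* → hits E parts ≤ hits E Old
      resplit-inside-hits N⊆D {E} E∈ with E ≟ D
      ... | yes refl = ≤-trans (length-filter (meets? D) parts) (≤-reflexive (sym hits-Old))
      ... | no E≢D   = ≤-trans (≤-reflexive (hits-parts-none (other-target N⊆D E∈ E≢D))) z≤n

      -- If neither A nor B is bad for D, then Y ⊆ D lies in one child of N, but N is minimal.
      some-bad : ¬ (N ⊆ D) → ∀ {E} → E ∈ˡ C* → Meets E Y → Any (Bad E) Old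
      some-bad N⊈D {E} E∈ E∩Y with bad? E A | bad? E B
      ... | yes bad | _       = here bad
      ... | no _    | yes bad = there (here bad)
      ... | no ¬badA | no ¬badB with unmeet E∩Y
      ...   | x , x∈E , x∈Y with E ≟ D
      ...     | yes refl = ⊥-elim (absurd (clean V D∈ D∩N N⊈D))
        where
        Y⊆D : Y ⊆ D
        Y⊆D = ∪-lub (¬bad⇒⊆ D∈ D∩A ¬badA) (¬bad⇒⊆ D∈ D∩B ¬badB)
        absurd : ¬ (D ⊆ ⟦ l ⟧ ⊎ D ⊆ ⟦ r ⟧)
        absurd (inj₁ D⊆l) = Y⊈l (⊆-trans Y⊆D D⊆l)
        absurd (inj₂ D⊆r) = Y⊈r (⊆-trans Y⊆D D⊆r)
      ...     | no E≢D with x∈p∪q⁻ A B x∈Y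
      ...       | inj₁ x∈A = ⊥-elim (E≢D (meets⇒≡ C*-cl E∈ D∈ (Meets-sym (Meets-mono id (¬bad⇒⊆ E∈ (meet x∈E x∈A) ¬badA) D∩A))))
      ...       | inj₂ x∈B = ⊥-elim (E≢D (meets⇒≡ C*-cl E∈ D∈ (Meets-sym (Meets-mono id (¬bad⇒⊆ E∈ (meet x∈E x∈B) ¬badB) D∩B))))

      resplit-hits : ∀ {E} → E ∈ˡ C* → hits E parts ≤ hits E Old
      resplit-hits E∈ with N ⊆? D
      ... | yes N⊆D = resplit-inside-hits N⊆D E∈
      ... | no N⊈D  = Clean.hits-parts-≤ (impure-hull V D∈ D∩N N⊈D) E∈ Old-covers

      resplit-bads : ∀ {E} → E ∈ˡ C* → bads E parts ≤ bads E Old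
      resplit-bads {E} E∈ with N ⊆? D
      ... | no N⊈D  = Clean.bads-parts-≤ (impure-hull V D∈ D∩N N⊈D) E∈ (some-bad N⊈D E∈)
      ... | yes N⊆D with E ≟ D
      ...   | yes refl = ≤-trans (≤-reflexive (resplit-inside-bads N⊆D)) z≤n
      ...   | no E≢D   = ≤-trans (bads≤hits E parts) (≤-trans (≤-reflexive (hits-parts-none (other-target N⊆D E∈ E≢D))) z≤n)

      resplit-replacement : Replacement Old parts
      resplit-replacement = record
        { nonempty      = parts-nonempty
        ; disjoint      = parts-disjoint
        ; covered⁺      = parts-covered⁺ ∘ Old-covered
        ; covered⁻      = Old-covers ∘ parts-covered⁻
        ; hits-≤        = resplit-hits
        ; nonIncreasing = λ {E} E∈ → nonIncreasing-≤ {Old} {parts} {E} (resplit-hits E∈) (resplit-bads E∈)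
        }

      -- If `N` is not inside `D`, at most one part meets `D`, where two clusters did. Inside `D`
      -- the gain is in the bad clusters: no part is bad, whereas `A` or `B` was. A separated pair
      -- cannot occur there, as the split would have returned it unchanged.
      resplit-decreasing : ¬ Same → Favourable D A B → Decreasing Old parts D
      resplit-decreasing ¬same fav with N ⊆? D
      ... | no N⊈D  = decreasing-hits {parts} (Clean.hits-parts (impure-hull V D∈ D∩N N⊈D) D∈)
      ... | yes N⊆D = within-D fav
        where
        within-D : Favourable D A B → Decreasing Old parts D
        within-D (inj₂ sep) q s = ⊥-elim (¬same (separated⇒same sep))
        within-D (inj₁ bad) q s rewrite hits-Old | resplit-inside-bads N⊆D =
          φ-fewer-bad (+-monoˡ-≤ q (length-filter (meets? D) parts)) (+-monoˡ-≤ s 1≤bads)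
          where
          1≤bads : 1 ≤ bads D Old
          1≤bads = count-some (bad? D) ([ here , there ∘ here ]′ bad)

      resplit-overclustering : overclustering parts ≤ overclustering Old
      resplit-overclustering with N ⊆? D
      ... | yes N⊆D = ≤-trans (≤-reflexive (cong₂ (λ a b → a + (b + 0)) (zero-spread (p∩q⊆p Y ⟦ l ⟧)) (zero-spread (p∩q⊆p Y ⟦ r ⟧)))) z≤n
        where
        zero-spread : ∀ {Z} → Z ⊆ Y → spread Z ∸ 1 ≡ 0
        zero-spread Z⊆Y = m≤n⇒m∸n≡0 (spread-pure D∈ (⊆-trans Z⊆Y (⊆-trans Y⊆l∪r N⊆D)))
      ... | no N⊈D  = +-cancelˡ-≤ 2 _ _ (begin
        2 + overclustering parts                    ≤⟨ Clean.2+overclustering-parts (impure-hull V D∈ D∩N N⊈D) ⟩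
        spread Y                                    ≤⟨ count-⊎ (meets? A) (meets? B) (meets? Y) (All.universal (λ _ → meets-∪) C*) ⟩
        spread A + spread B                         ≤⟨ +-mono-≤ (m≤n+m∸n (spread A) 1) (m≤n+m∸n (spread B) 1) ⟩
        suc (spread A ∸ 1) + suc (spread B ∸ 1)     ≡⟨ cong suc (+-suc (spread A ∸ 1) _) ⟩
        2 + (spread A ∸ 1 + (spread B ∸ 1))         ≡⟨ cong (λ m → 2 + (spread A ∸ 1 + m)) (+-identityʳ _) ⟨
        2 + overclustering Old                      ∎)
        where
        open ≤-Reasoning
        meets-∪ : ∀ {E} → Meets Y E → Meets A E ⊎ Meets B E
        meets-∪ Y∩E with x , x∈Y , x∈E ← unmeet Y∩E with x∈p∪q⁻ A B x∈Y
        ... | inj₁ x∈A = inj₁ (meet x∈A x∈E)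
        ... | inj₂ x∈B = inj₂ (meet x∈B x∈E)

      record Outcome (R M : Clustering n) : Set where
        constructor outcome
        field
          {New}           : Clustering n
          result          : M ≡ New ++ R
          replacement     : Replacement Old New
          decreasing      : Favourable D A B → Decreasing Old New D
          overclustering≤ : overclustering New ≤ overclustering Old

      merge-outcome : ∀ C → Outcome (delete A (delete B C)) (mergeClusters (A , B) C)
      merge-outcome C with Split T (A ∪ B) | SplitView.split≡ V
      ... | _ | refl with (Yˡ ≟ A ×-dec Yʳ ≟ B) ⊎-dec (Yˡ ≟ B ×-dec Yʳ ≟ A)
      ...   | yes same = outcome refl (merged-replacement same) (λ _ → merged-decreasing) (merged-overclustering same)
      ...   | no ¬same = outcome refl resplit-replacement (resplit-decreasing ¬same) resplit-overclustering

  -- Sums, counts and powers of 2 over lists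

  module _ {a} {A : Set a} where
    AllPairs-++⁻ : ∀ {r} {R : A → A → Set r} xs {ys} → AllPairs R (xs ++ ys) →
                   AllPairs R ys × All (λ x → All (R x) ys) xs
    AllPairs-++⁻ []       ys            = ys , []
    AllPairs-++⁻ (x ∷ xs) (Rx ∷ rest) with AllPairs-++⁻ xs rest
    ... | ys , cross = ys , All.++⁻ʳ xs Rx ∷ cross

    sum-map-mono-≤ : ∀ {f g : A → ℕ} {xs} → All (λ x → f x ≤ g x) xs → sum (map f xs) ≤ sum (map g xs)
    sum-map-mono-≤ []         = z≤n
    sum-map-mono-≤ (le ∷ les) = +-mono-≤ le (sum-map-mono-≤ les)

    sum-map-mono-< : ∀ {f g : A → ℕ} {xs} → All (λ x → f x ≤ g x) xs → ∀ {x} → x ∈ˡ xs → f x < g x →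
                     sum (map f xs) < sum (map g xs)
    sum-map-mono-< (_ ∷ les)  (here refl) lt = +-mono-<-≤ lt (sum-map-mono-≤ les)
    sum-map-mono-< (le ∷ les) (there x∈)  lt = +-mono-≤-< le (sum-map-mono-< les x∈ lt)

    sum-map-* : ∀ (f : A → ℕ) k xs → sum (map (λ x → f x * k) xs) ≡ sum (map f xs) * k
    sum-map-* f k []       = refl
    sum-map-* f k (x ∷ xs) = trans (cong (f x * k +_) (sum-map-* f k xs)) (sym (*-distribʳ-+ k (f x) _))

    module _ {p} {P : Pred A p} (P? : Decidable P) where
      count-at-most-once : ∀ {xs} → AllPairs (λ x y → ¬ (P x × P y)) xs → count P? xs ≤ 1
      count-at-most-once []                          = z≤n
      count-at-most-once {x ∷ xs} (excl ∷ rest) with P? x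
      ... | yes Px = s≤s (≤-reflexive (count-none P? (All.map (λ ¬both Py → ¬both (Px , Py)) excl)))
      ... | no _   = count-at-most-once rest

      count-two : ∀ {r} {R : A → A → Set r} {xs} → AllPairs R xs → 2 ≤ count P? xs →
                  ∃[ x ] ∃[ y ] P x × P y × R x y
      count-two {xs = x ∷ xs} (Rx ∷ rest) 2≤ with P? x
      ... | no _   = count-two rest 2≤
      ... | yes Px with filter P? xs in eq
      ...   | []    = ⊥-elim (<-irrefl refl 2≤)
      ...   | y ∷ _ = x , y , Px , proj₂ y∈ , All.lookup Rx (proj₁ y∈)
        where y∈ = ∈-filter⁻ P? (subst (y ∈ˡ_) (sym eq) (here refl))

    module _ {b p} {B : Set b} {P : Pred B p} (P? : Decidable P) (f : A → B) where
      count-map : ∀ xs → count P? (map f xs) ≡ count (λ x → P? (f x)) xs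
      count-map []       = refl
      count-map (x ∷ xs) with P? (f x)
      ... | yes _ = cong suc (count-map xs)
      ... | no _  = count-map xs

    count-filter : ∀ {p q} {P : Pred A p} {Q : Pred A q} (P? : Decidable P) (Q? : Decidable Q) xs →
                   count (λ x → Q? x ×-dec P? x) xs ≡ count P? (filter Q? xs)
    count-filter P? Q? [] = refl
    count-filter P? Q? (x ∷ xs) with Q? x
    ... | no _  = count-filter P? Q? xs
    ... | yes _ with P? x
    ...   | yes _ = cong suc (count-filter P? Q? xs)
    ...   | no _  = count-filter P? Q? xs

    count-any : ∀ {b r} {B : Set b} {R : B → Pred A r} (R? : ∀ y → Decidable (R y)) ys xs →
                count (λ x → any? (λ y → R? y x) ys) xs ≤ sum (map (λ y → count (R? y) xs) ys)
    count-any R? []       xs = ≤-reflexive (count-none (λ x → any? (λ y → R? y x) []) (All.universal (λ _ → Any.¬Any[]) xs))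
    count-any R? (y ∷ ys) xs = ≤-trans
      (count-⊎ (R? y) (λ x → any? (λ z → R? z x) ys) (λ x → any? (λ z → R? z x) (y ∷ ys)) (All.universal (λ _ → Any.toSum) xs))
      (+-monoʳ-≤ _ (count-any R? ys xs))

    -- An element dropping below F saves at least half of 2 ^ F.
    sum-2^-progress : ∀ (f : A → ℕ) {F p} {P : Pred A p} (P? : Decidable P) → (∀ {x} → P x → f x < F) →
                      ∀ {xs} → All (λ x → f x ≤ F) xs →
                      2 * sum (map (λ x → 2 ^ f x) xs) + count P? xs * 2 ^ F ≤ 2 * (length xs * 2 ^ F)
    sum-2^-progress f     P? P⇒< []                     = z≤n
    sum-2^-progress f {F} P? P⇒< {x ∷ xs} (le ∷ les) with P? x
    ... | yes Px = begin
      2 * (2 ^ f x + Σ) + (2 ^ F + g * 2 ^ F)        ≡⟨ regroup (2 ^ f x) Σ (2 ^ F) (g * 2 ^ F) ⟩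
      2 * 2 ^ f x + 2 ^ F + (2 * Σ + g * 2 ^ F)      ≤⟨ +-mono-≤ (+-monoˡ-≤ (2 ^ F) (^-monoʳ-≤ 2 (P⇒< Px))) (sum-2^-progress f P? P⇒< les) ⟩
      2 ^ F + 2 ^ F + 2 * (length xs * 2 ^ F)        ≡⟨ regroup′ (2 ^ F) (length xs * 2 ^ F) ⟩
      2 * (2 ^ F + length xs * 2 ^ F)                ∎
      where
      open ≤-Reasoning
      Σ = sum (map (λ x → 2 ^ f x) xs)
      g = count P? xs
      regroup : ∀ a b c d → 2 * (a + b) + (c + d) ≡ 2 * a + c + (2 * b + d)
      regroup = solve-∀
      regroup′ : ∀ a b → a + a + 2 * b ≡ 2 * (a + b)
      regroup′ = solve-∀
    ... | no _ = begin
      2 * (2 ^ f x + Σ) + g * 2 ^ F                  ≡⟨ regroup (2 ^ f x) Σ (g * 2 ^ F) ⟩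
      2 * 2 ^ f x + (2 * Σ + g * 2 ^ F)              ≤⟨ +-mono-≤ (*-monoʳ-≤ 2 (^-monoʳ-≤ 2 le)) (sum-2^-progress f P? P⇒< les) ⟩
      2 * 2 ^ F + 2 * (length xs * 2 ^ F)            ≡⟨ *-distribˡ-+ 2 (2 ^ F) _ ⟨
      2 * (2 ^ F + length xs * 2 ^ F)                ∎
      where
      open ≤-Reasoning
      Σ = sum (map (λ x → 2 ^ f x) xs)
      g = count P? xs
      regroup : ∀ a b d → 2 * (a + b) + d ≡ 2 * a + (2 * b + d)
      regroup = solve-∀

  -- This is `(a - 1) (b - 1) ≥ 0`. With `a` clusters below one child and `b` below the other, there
  -- are at least `a + b - 1` pairs across.
  a+b≤1+ab : ∀ {a b} → 1 ≤ a → 1 ≤ b → a + b ≤ suc (a * b)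
  a+b≤1+ab {suc a} {suc b} _ _ = begin
    suc a + suc b              ≤⟨ m≤m+n _ (a * b) ⟩
    suc a + suc b + a * b      ≡⟨ regroup a b ⟩
    suc (suc a * suc b)        ∎
    where
    open ≤-Reasoning
    regroup : ∀ a b → suc a + suc b + a * b ≡ suc (suc a * suc b)
    regroup = solve-∀

  -- For `p ≥ 2` the bad clusters number at most `p ≤ 2 (p - 1)`, so they at most double the first
  -- term.
  φ≤4δ : ∀ {p b} → b ≤ p → φ p b ≤ 4 * (p ∸ 1)
  φ≤4δ {zero}        _   = z≤n
  φ≤4δ {suc zero}    _   = z≤n
  φ≤4δ {suc (suc p)} {b} b≤p = begin
    2 * suc p + b                ≤⟨ +-monoʳ-≤ (2 * suc p) b≤p ⟩
    2 * suc p + suc (suc p)      ≤⟨ m≤m+n _ p ⟩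
    2 * suc p + suc (suc p) + p  ≡⟨ regroup p ⟩
    4 * suc p                    ∎
    where
    open ≤-Reasoning
    regroup : ∀ p → 2 * suc p + suc (suc p) + p ≡ 4 * suc p
    regroup = solve-∀

  -- The effect of a request on the whole clustering

  module Dynamics {n} {T : Tree n} {C* C₀ : Clustering n} (C*-cl : IsClustering C*)
                  (T-lam : Laminar C* T) (T-all : ∀ x → x ∈ ⟦ T ⟧) where
    open LaminarTree C*-cl T-lam T-all
    open Replacements {C₀ = C₀} C*-cl T-lam T-all
    open Interaction T C* C₀

    Unique : Clustering n → Set
    Unique = AllPairs _≢_

    unique : ∀ {C} → IsClustering C → Unique C
    unique {C} C-cl = go nonempty disjoint
      where
      open IsClustering C-cl
      go : ∀ {C} → All Nonempty C → AllPairs Disjoint C → Unique C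
      go []               []          = []
      go ((x , x∈A) ∷ ne) (A∥C ∷ dis) = All.map (λ { A∥A refl → A∥A (meet x∈A x∈A) }) A∥C ∷ go ne dis

    -- `delete` filters out every copy; it removes exactly one because there are no duplicates.
    delete-↭ : ∀ {A C} → Unique C → A ∈ˡ C → C ↭ A ∷ delete A C
    delete-↭ {A} {B ∷ C} (B≢ ∷ uniq) A∈ with B ≟ A | A∈
    ... | yes refl | _         = prep A (subst (C ↭_) (sym (filter-all (λ D → ¬? (D ≟ A)) (All.map (λ B≢D D≡B → B≢D (sym D≡B)) B≢))) ↭-refl)
    ... | no B≢A   | here A≡B  = ⊥-elim (B≢A (sym A≡B))
    ... | no _     | there A∈C = ↭-trans (prep B (delete-↭ uniq A∈C)) (swap B A ↭-refl)

    delete-pair-↭ : ∀ {A B C} → Unique C → A ∈ˡ C → B ∈ˡ C → A ≢ B → C ↭ A ∷ B ∷ delete A (delete B C)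
    delete-pair-↭ {A} {B} uniq A∈ B∈ A≢B = ↭-trans (delete-↭ uniq B∈)
      (↭-trans (prep B (delete-↭ (AllPairs.filter⁺ (λ D → ¬? (D ≟ B)) uniq) (∈-filter⁺ (λ D → ¬? (D ≟ B)) A∈ A≢B))) (swap B A ↭-refl))

    potential : Clustering n → ℕ
    potential C = sum (map (λ D → φ (hits D C) (bads D C)) C*)

    potential≤4δ : ∀ C → potential C ≤ 4 * dist C* C
    potential≤4δ C = begin
      potential C                                          ≤⟨ sum-map-mono-≤ (All.universal (λ D → φ≤4δ (bads≤hits D C)) C*) ⟩
      sum (map (λ D → 4 * (hits D C ∸ 1)) C*)              ≤⟨ sum-map-mono-≤ (All.universal (λ D → ≤-reflexive (*-comm 4 (hits D C ∸ 1))) C*) ⟩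
      sum (map (λ D → (hits D C ∸ 1) * 4) C*)              ≡⟨ sum-map-* (λ D → hits D C ∸ 1) 4 C* ⟩
      dist C* C * 4                                        ≡⟨ *-comm (dist C* C) 4 ⟩
      4 * dist C* C                                        ∎
      where open ≤-Reasoning

    -- Lifts a local exchange to the whole clustering: the untouched clusters `R` supply the context
    -- `q`, `s` of `NonIncreasing` and `Decreasing`.
    module Replace {C Old New R} (C-cl : IsClustering C) (C↭ : C ↭ Old ++ R) (rep : Replacement Old New) where
      open Replacement rep

      Old-disjoint : AllPairs Disjoint (Old ++ R)
      Old-disjoint = AllPairs-resp-↭ Disjoint-sym C↭ (IsClustering.disjoint C-cl)

      isClustering : IsClustering (New ++ R)
      isClustering = record
        { nonempty = All.++⁺ nonempty (All.++⁻ʳ Old (All-resp-↭ C↭ (IsClustering.nonempty C-cl)))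
        ; disjoint = AllPairs.++⁺ disjoint (proj₁ (AllPairs-++⁻ Old Old-disjoint))
            (All.tabulate λ P∈New → All.tabulate λ Q∈R P∩Q → let x , x∈P , x∈Q = unmeet P∩Q in cross x x∈Q Q∈R (covered⁻ (lose P∈New x∈P)))
        ; covering = λ x → [ (λ p → Any.++⁺ˡ (covered⁺ p)) , Any.++⁺ʳ New ]′
            (Any.++⁻ Old (Any-resp-↭ C↭ (IsClustering.covering C-cl x)))
        }
        where
        cross : ∀ x {Q} → x ∈ Q → Q ∈ˡ R → ¬ Any (x ∈_) Old
        cross x x∈Q Q∈R x∈Old with P , P∈ , x∈P ← find x∈Old =
          All.lookup (All.lookup (proj₂ (AllPairs-++⁻ Old Old-disjoint)) P∈) Q∈R (meet x∈P x∈Q)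

      hits-old : ∀ D → hits D C ≡ hits D Old + hits D R
      hits-old D = trans (count-↭ (meets? D) C↭) (count-++ (meets? D) Old R)

      bads-old : ∀ D → bads D C ≡ bads D Old + bads D R
      bads-old D = trans (count-↭ (bad? D) C↭) (count-++ (bad? D) Old R)

      φ-new : ∀ D → φ (hits D (New ++ R)) (bads D (New ++ R)) ≡ φ (hits D New + hits D R) (bads D New + bads D R)
      φ-new D = cong₂ φ (count-++ (meets? D) New R) (count-++ (bad? D) New R)

      φ-old : ∀ D → φ (hits D C) (bads D C) ≡ φ (hits D Old + hits D R) (bads D Old + bads D R)
      φ-old D = cong₂ φ (hits-old D) (bads-old D)

      φ-≤ : All (λ D → φ (hits D (New ++ R)) (bads D (New ++ R)) ≤ φ (hits D C) (bads D C)) C*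
      φ-≤ = All.tabulate λ {D} D∈ → ≤-trans (≤-reflexive (φ-new D))
        (≤-trans (nonIncreasing D∈ (hits D R) (bads D R)) (≤-reflexive (sym (φ-old D))))

      potential-≤ : potential (New ++ R) ≤ potential C
      potential-≤ = sum-map-mono-≤ φ-≤

      potential-< : ∀ {D} → D ∈ˡ C* → Decreasing Old New D → potential (New ++ R) < potential C
      potential-< {D} D∈ dec = sum-map-mono-< φ-≤ D∈ (≤-trans (s≤s (≤-reflexive (φ-new D)))
        (≤-trans (dec (hits D R) (bads D R)) (≤-reflexive (sym (φ-old D)))))

      underclustering-≤ : dist C* (New ++ R) ≤ dist C* C
      underclustering-≤ = sum-map-mono-≤ (All.tabulate λ {D} D∈ → ∸-monoˡ-≤ 1
        (≤-trans (≤-reflexive (count-++ (meets? D) New R)) (≤-trans (+-monoˡ-≤ (hits D R) (hits-≤ D∈)) (≤-reflexive (sym (hits-old D))))))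

      overclustering-new : dist (New ++ R) C* ≡ overclustering New + overclustering R
      overclustering-new = trans (cong sum (map-++ _ New R)) (sum-++ (map _ New) (map _ R))

      overclustering-old : dist C C* ≡ overclustering Old + overclustering R
      overclustering-old = trans (sum-↭ (map-↭ _ C↭)) (trans (cong sum (map-++ _ Old R)) (sum-++ (map _ Old) (map _ R)))

      overclustering-≤ : overclustering New ≤ overclustering Old → dist (New ++ R) C* ≤ dist C C*
      overclustering-≤ le rewrite overclustering-new | overclustering-old = +-monoˡ-≤ _ le

      overclustering-< : overclustering New < overclustering Old → dist (New ++ R) C* < dist C C*
      overclustering-< lt rewrite overclustering-new | overclustering-old = +-monoˡ-< _ lt

    record Split-effect (C C′ : Clustering n) : Set where
      field
        isClustering      : IsClustering C′
        potential-≤       : potential C′ ≤ potential C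
        underclustering-≤ : dist C* C′ ≤ dist C* C
        overclustering-<  : dist C′ C* < dist C C*

    split-effect : ∀ {C A} → IsClustering C → A ∈ˡ C → Impure A → Split-effect C (splitCluster A C)
    split-effect {C} {A} C-cl A∈ (D , D′ , D∈ , D′∈ , D≢D′ , A∩D , A∩D′) =
      subst (λ (A₁ , A₂) → Split-effect C (A₁ ∷ A₂ ∷ delete A C)) (sym (SplitView.split≡ V)) (record
        { isClustering      = isClustering
        ; potential-≤       = potential-≤
        ; underclustering-≤ = underclustering-≤
        ; overclustering-<  = overclustering-< S.overclustering-<
        })
      where
      module S = SplitStep D∈ D′∈ D≢D′ A∩D A∩D′
      open S using (V)
      open Replace C-cl (delete-↭ (unique C-cl) A∈) S.replacement

    record Merge-effect (C C′ : Clustering n) : Set where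
      field
        isClustering      : IsClustering C′
        potential-≤       : potential C′ ≤ potential C
        underclustering-≤ : dist C* C′ ≤ dist C* C
        overclustering-≤  : dist C′ C* ≤ dist C C*

    module _ {C A B D} (C-cl : IsClustering C) (A∈ : A ∈ˡ C) (B∈ : B ∈ˡ C) (A≢B : A ≢ B)
             (D∈ : D ∈ˡ C*) (D∩A : Meets D A) (D∩B : Meets D B) where
      private
        open MergeStep (distinct⇒disjoint C-cl A∈ B∈ A≢B) D∈ D∩A D∩B using (Outcome; merge-outcome)
        module O = Outcome (merge-outcome C)
        module R = Replace C-cl (delete-pair-↭ (unique C-cl) A∈ B∈ A≢B) O.replacement

      merge-effect : Merge-effect C (mergeClusters (A , B) C)
      merge-effect = subst (Merge-effect C) (sym O.result) record
        { isClustering      = R.isClustering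
        ; potential-≤       = R.potential-≤
        ; underclustering-≤ = R.underclustering-≤
        ; overclustering-≤  = R.overclustering-≤ O.overclustering≤
        }

      merge-progress : Favourable D A B → potential (mergeClusters (A , B) C) < potential C
      merge-progress fav = subst (λ C′ → potential C′ < potential C) (sym O.result) (R.potential-< D∈ (O.decreasing fav))

    -- How many merge pairs lower the potential

    unorderedPairs-∈ : ∀ {C} → Unique C → All (λ (A , B) → A ∈ˡ C × B ∈ˡ C × A ≢ B) (unorderedPairs C)
    unorderedPairs-∈ []           = []
    unorderedPairs-∈ (A≢ ∷ uniq) = All.++⁺
      (All.map⁺ (All.tabulate λ B∈ → here refl , there B∈ , All.lookup A≢ B∈))
      (All.map (λ (A∈ , B∈ , A≢B) → there A∈ , there B∈ , A≢B) (unorderedPairs-∈ uniq))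

    module _ {p} {P : Pred (Subset n × Subset n) p} (P? : Decidable P) where
      count-unorderedPairs-∷ : ∀ A C → count P? (unorderedPairs (A ∷ C)) ≡ count (λ B → P? (A , B)) C + count P? (unorderedPairs C)
      count-unorderedPairs-∷ A C = trans (count-++ P? (map (A ,_) C) (unorderedPairs C)) (cong (_+ _) (count-map P? (A ,_) C))

      -- A pair occurs in `unorderedPairs` in one order only, dictated by the list; this is why `P`
      -- is required in both orders.
      count-product : ∀ {q₁ q₂} {Q₁ : Pred (Subset n) q₁} {Q₂ : Pred (Subset n) q₂} (Q₁? : Decidable Q₁) (Q₂? : Decidable Q₂) →
        (∀ {A} → Q₁ A → ¬ Q₂ A) → ∀ C →
        (∀ {A B} → A ∈ˡ C → B ∈ˡ C → Q₁ A → Q₂ B → P (A , B) × P (B , A)) →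
        count Q₁? C * count Q₂? C ≤ count P? (unorderedPairs C)
      count-product Q₁? Q₂? excl []      all = z≤n
      count-product Q₁? Q₂? excl (A ∷ C) all
        rewrite count-unorderedPairs-∷ A C
        with Q₁? A | Q₂? A | count-product Q₁? Q₂? excl C (λ A∈ B∈ → all (there A∈) (there B∈))
      ... | yes q₁ | yes q₂ | ih = ⊥-elim (excl q₁ q₂)
      ... | yes q₁ | no _   | ih = +-mono-≤ (count-mono Q₂? (λ B → P? (A , B)) (All.tabulate λ B∈ q₂ → proj₁ (all (here refl) (there B∈) q₁ q₂))) ih
      ... | no _   | yes q₂ | ih = ≤-trans (≤-reflexive (*-suc (count Q₁? C) (count Q₂? C)))
        (+-mono-≤ (count-mono Q₁? (λ B → P? (A , B)) (All.tabulate λ B∈ q₁ → proj₂ (all (there B∈) (here refl) q₁ q₂))) ih)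
      ... | no _   | no _   | ih = ≤-trans ih (m≤n+m _ _)

    -- The true number is `m (m - 1) / 2`. The square is weaker but has the shape needed later,
    -- where one factor `m - 1` is bounded by the number of progress pairs and the other is summed
    -- to the underclustering error.
    count-both : ∀ {q} {Q : Pred (Subset n) q} (Q? : Decidable Q) C →
      count (λ (A , B) → Q? A ×-dec Q? B) (unorderedPairs C) ≤ (count Q? C ∸ 1) * (count Q? C ∸ 1)
    count-both Q? []      = z≤n
    count-both {Q = Q} Q? (A ∷ C)
      rewrite count-unorderedPairs-∷ (λ (A , B) → Q? A ×-dec Q? B) A C
      with Q? A
    ... | no ¬q = ≤-trans (≤-reflexive (cong (_+ _) (count-none (λ B → no ¬q ×-dec Q? B) (All.universal (λ _ → ¬q ∘ proj₁) C)))) (count-both Q? C)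
    ... | yes q = ≤-trans (+-mono-≤ (count-mono (λ B → yes q ×-dec Q? B) Q? (All.universal (λ _ → proj₂) C)) (count-both Q? C)) (square (count Q? C))
      where
      square : ∀ m → m + (m ∸ 1) * (m ∸ 1) ≤ m * m
      square zero    = z≤n
      square (suc m) = +-monoʳ-≤ (suc m) (*-monoʳ-≤ m (n≤1+n m))

    progress? : ∀ C → Decidable (λ pr → potential (mergeClusters pr C) < potential C)
    progress? C pr = potential (mergeClusters pr C) <? potential C

    progressPairs : Clustering n → ℕ
    progressPairs C = count (progress? C) (mergePairs C)

    module _ {C : Clustering n} (C-cl : IsClustering C) where
      all-merge-effects : All (λ pr → Merge-effect C (mergeClusters pr C)) (mergePairs C)
      all-merge-effects = All.tabulate λ pr∈ → effect (∈-filter⁻ meetCommonTarget? pr∈)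
        where
        effect : ∀ {pr} → pr ∈ˡ unorderedPairs C × MeetCommonTarget pr → Merge-effect C (mergeClusters pr C)
        effect (pr∈ , common) with A∈ , B∈ , A≢B ← All.lookup (unorderedPairs-∈ (unique C-cl)) pr∈
                                 | D , D∈ , D∩A , D∩B ← find common =
          merge-effect C-cl A∈ B∈ A≢B D∈ D∩A D∩B

      private
        favourable-product : ∀ {D} → D ∈ˡ C* → ∀ {q₁ q₂} {Q₁ : Pred (Subset n) q₁} {Q₂ : Pred (Subset n) q₂}
          (Q₁? : Decidable Q₁) (Q₂? : Decidable Q₂) → (∀ {A} → Q₁ A → ¬ Q₂ A) →
          (∀ {A B} → A ∈ˡ C → B ∈ˡ C → Q₁ A → Q₂ B → Meets D A × Meets D B × Favourable D A B × Favourable D B A) →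
          count Q₁? C * count Q₂? C ≤ progressPairs C
        favourable-product {D} D∈ {Q₁ = Q₁} {Q₂} Q₁? Q₂? excl fav = ≤-trans
          (count-product (λ pr → meetCommonTarget? pr ×-dec progress? C pr) Q₁? Q₂? excl C both)
          (≤-reflexive (count-filter (progress? C) meetCommonTarget? (unorderedPairs C)))
          where
          both : ∀ {A B} → A ∈ˡ C → B ∈ˡ C → Q₁ A → Q₂ B →
                 (MeetCommonTarget (A , B) × potential (mergeClusters (A , B) C) < potential C) ×
                 (MeetCommonTarget (B , A) × potential (mergeClusters (B , A) C) < potential C)
          both A∈ B∈ q₁ q₂ with D∩A , D∩B , favAB , favBA ← fav A∈ B∈ q₁ q₂ =
            (lose D∈ (D∩A , D∩B) , merge-progress C-cl A∈ B∈ A≢B D∈ D∩A D∩B favAB) ,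
            (lose D∈ (D∩B , D∩A) , merge-progress C-cl B∈ A∈ (A≢B ∘ sym) D∈ D∩B D∩A favBA)
            where
            A≢B : _ ≢ _
            A≢B refl = excl q₁ q₂

      hits-1≤progressPairs : ∀ {D} → D ∈ˡ C* → hits D C ∸ 1 ≤ progressPairs C
      hits-1≤progressPairs {D} D∈ with 2 ≤? hits D C
      ... | no ≱2 = ≤-trans (≤-reflexive (m≤n⇒m∸n≡0 (ℕ.≤-pred (≰⇒> ≱2)))) z≤n
      ... | yes 2≤hits with any? (bad? D) C
      ...   | yes some-bad = bad-star (find some-bad)
        where
        bad-star : (∃[ A ] A ∈ˡ C × Bad D A) → hits D C ∸ 1 ≤ progressPairs C
        bad-star (A , A∈ , bad) = begin
          hits D C ∸ 1                              ≤⟨ ∸-monoˡ-≤ 1 (count-⊎ (A ≟_) other? (meets? D) (All.universal (λ B → cases B) C)) ⟩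
          count (A ≟_) C + count other? C ∸ 1       ≤⟨ ∸-monoˡ-≤ 1 (+-monoˡ-≤ _ at-most-one) ⟩
          count other? C                            ≡⟨ *-identityˡ _ ⟨
          1 * count other? C                        ≤⟨ *-monoˡ-≤ _ (count-some (A ≟_) A∈) ⟩
          count (A ≟_) C * count other? C           ≤⟨ favourable-product D∈ (A ≟_) other? (λ A≡B (A≢B , _) → A≢B A≡B)
                                                         (λ { _ _ refl (_ , D∩B) → proj₁ bad , D∩B , inj₁ (inj₁ bad) , inj₁ (inj₂ bad) }) ⟩
          progressPairs C                           ∎
          where
          open ≤-Reasoning
          other? : Decidable (λ B → A ≢ B × Meets D B)
          other? B = ¬? (A ≟ B) ×-dec meets? D B
          cases : ∀ B → Meets D B → A ≡ B ⊎ A ≢ B × Meets D B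
          cases B D∩B with A ≟ B
          ... | yes A≡B = inj₁ A≡B
          ... | no A≢B  = inj₂ (A≢B , D∩B)
          at-most-one : count (A ≟_) C ≤ 1
          at-most-one = count-at-most-once (A ≟_) (AllPairs.map (λ { B≢B′ (refl , refl) → B≢B′ refl }) (unique C-cl))
      ...   | no none-bad = begin
          hits D C ∸ 1                              ≤⟨ ∸-monoˡ-≤ 1 (count-⊎ left? right? (meets? D) (All.tabulate side)) ⟩
          count left? C + count right? C ∸ 1        ≤⟨ ∸-monoˡ-≤ 1 (a+b≤1+ab 1≤left 1≤right) ⟩
          count left? C * count right? C            ≤⟨ favourable-product D∈ left? right?
                                                         (λ (D∩A , A⊆l) (_ , A⊆r) → let x , _ , x∈A = unmeet D∩A in l∥r (meet (A⊆l x∈A) (A⊆r x∈A)))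
                                                         (λ A∈ B∈ (D∩A , A⊆l) (D∩B , B⊆r) →
                                                           let sep = separates V (within-D A∈ D∩A) (within-D B∈ D∩B) A⊆l B⊆r in
                                                           D∩A , D∩B , inj₂ (inj₁ sep) , inj₂ (inj₂ sep)) ⟩
          progressPairs C                           ∎
        where
        open ≤-Reasoning
        V : SplitView D
        V with A , B , D∩A , D∩B , A∥B ← count-two (meets? D) (IsClustering.disjoint C-cl) 2≤hits
             with x , x∈D , x∈A ← unmeet D∩A | y , y∈D , y∈B ← unmeet D∩B =
          view x∈D y∈D λ { refl → A∥B (meet x∈A y∈B) }
        open SplitView V
        left? : Decidable (λ A → Meets D A × A ⊆ ⟦ l ⟧)
        left? A = meets? D A ×-dec A ⊆? ⟦ l ⟧
        right? : Decidable (λ A → Meets D A × A ⊆ ⟦ r ⟧)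
        right? A = meets? D A ×-dec A ⊆? ⟦ r ⟧
        good : ∀ {A} → A ∈ˡ C → ¬ Bad D A
        good A∈ bad = none-bad (lose A∈ bad)
        within-D : ∀ {A} → A ∈ˡ C → Meets D A → A ⊆ D
        within-D A∈ D∩A = ¬bad⇒⊆ D∈ D∩A (good A∈)
        side : ∀ {A} → A ∈ˡ C → Meets D A → Meets D A × A ⊆ ⟦ l ⟧ ⊎ Meets D A × A ⊆ ⟦ r ⟧
        side {A} A∈ D∩A with A ⊆? ⟦ l ⟧ | A ⊆? ⟦ r ⟧
        ... | yes A⊆l | _       = inj₁ (D∩A , A⊆l)
        ... | no _    | yes A⊆r = inj₂ (D∩A , A⊆r)
        -- A cluster inside `D` that fits in neither child has the node `D` as its hull, so it would
        -- be bad.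
        ... | no A⊈l  | no A⊈r  = ⊥-elim (good A∈ (D∩A , subst (λ t → D ⊆ ⟦ t ⟧)
          (sym (trans (deepest-within V (let x , _ , x∈A = unmeet D∩A in x , x∈A) (within-D A∈ D∩A)) (deepest-node l r A⊈l A⊈r))) Y⊆l∪r))
        1≤left : 1 ≤ count left? C
        1≤left with x , x∈ ← Yˡ≠∅ | x∈p∩q⁻ D ⟦ l ⟧ (proj₂ Yˡ≠∅) | clusterOf C-cl (proj₁ Yˡ≠∅)
        ... | x∈D , x∈l | A , A∈ , x∈A with side A∈ (meet x∈D x∈A)
        ...   | inj₁ q         = count-some left? (lose A∈ q)
        ...   | inj₂ (_ , A⊆r) = ⊥-elim (l∥r (meet x∈l (A⊆r x∈A)))
        1≤right : 1 ≤ count right? C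
        1≤right with x , x∈ ← Yʳ≠∅ | x∈p∩q⁻ D ⟦ r ⟧ (proj₂ Yʳ≠∅) | clusterOf C-cl (proj₁ Yʳ≠∅)
        ... | x∈D , x∈r | A , A∈ , x∈A with side A∈ (meet x∈D x∈A)
        ...   | inj₂ q         = count-some right? (lose A∈ q)
        ...   | inj₁ (_ , A⊆l) = ⊥-elim (l∥r (meet (A⊆l x∈A) x∈r))

      -- For each target separately, one factor `hits D C ∸ 1` of the square is replaced by the
      -- total number of progress pairs. Thus it does not matter that targets may share progress
      -- pairs.
      mergePairs≤ : length (mergePairs C) ≤ dist C* C * progressPairs C
      mergePairs≤ = begin
        length (mergePairs C)
          ≤⟨ count-any (λ D (A , B) → meets? D A ×-dec meets? D B) C* (unorderedPairs C) ⟩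
        sum (map (λ D → count (λ (A , B) → meets? D A ×-dec meets? D B) (unorderedPairs C)) C*)
          ≤⟨ sum-map-mono-≤ (All.tabulate λ {D} D∈ → ≤-trans (count-both (meets? D) C) (*-monoʳ-≤ (hits D C ∸ 1) (hits-1≤progressPairs D∈))) ⟩
        sum (map (λ D → (hits D C ∸ 1) * progressPairs C) C*)
          ≡⟨ sum-map-* (λ D → hits D C ∸ 1) (progressPairs C) C* ⟩
        dist C* C * progressPairs C
          ∎
        where open ≤-Reasoning

      -- At least a fraction `1 / suc δ` of the pairs at least halves the power. This leaves the
      -- mean factor `1 - 1 / (2 suc δ)`, the inverse of the growth rate; denominators are cleared
      -- to stay in `ℕ`.
      sum-potential : ∀ δ → dist C* C ≤ δ →
        (2 + 2 * δ) * sum (map (λ pr → 2 ^ potential (mergeClusters pr C)) (mergePairs C)) ≤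
        (1 + 2 * δ) * (length (mergePairs C) * 2 ^ potential C)
      sum-potential δ dist≤δ = +-cancelʳ-≤ (M * F) _ _ (begin
        (2 + 2 * δ) * Σ + M * F                     ≤⟨ +-monoʳ-≤ ((2 + 2 * δ) * Σ) (*-monoˡ-≤ F M≤) ⟩
        (2 + 2 * δ) * Σ + suc δ * G * F             ≡⟨ regroup δ Σ G F ⟩
        suc δ * (2 * Σ + G * F)                     ≤⟨ *-monoʳ-≤ (suc δ) (sum-2^-progress _ (progress? C) id (All.map Merge-effect.potential-≤ all-merge-effects)) ⟩
        suc δ * (2 * (M * F))                       ≡⟨ regroup′ δ (M * F) ⟩
        (1 + 2 * δ) * (M * F) + M * F               ∎)
        where
        open ≤-Reasoning
        M = length (mergePairs C)
        G = progressPairs C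
        F = 2 ^ potential C
        Σ = sum (map (λ pr → 2 ^ potential (mergeClusters pr C)) (mergePairs C))
        -- Passing from `δ` to `suc δ` keeps the denominator `1 + 2 δ` of the growth rate positive
        -- also for `δ = 0`.
        M≤ : M ≤ suc δ * G
        M≤ = ≤-trans mergePairs≤ (*-monoˡ-≤ G (m≤n⇒m≤1+n dist≤δ))
        regroup : ∀ δ Σ G F → (2 + 2 * δ) * Σ + suc δ * G * F ≡ suc δ * (2 * Σ + G * F)
        regroup = solve-∀
        regroup′ : ∀ δ X → suc δ * (2 * X) ≡ (1 + 2 * δ) * X + X
        regroup′ = solve-∀

    -- Invariants of the reachable clusterings

    module _ (C₀-cl : IsClustering C₀) where
      -- `merged⇒1≤δᵤ` settles the case `δᵤ = 0`, where the bound on the merges is 0 and no merge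
      -- may be allowed at all.
      record Reachable (C : Clustering n) (s m : ℕ) : Set where
        field
          isClustering      : IsClustering C
          overclustering-≤  : s + dist C C* ≤ dist C₀ C*
          underclustering-≤ : dist C* C ≤ dist C* C₀
          merged⇒1≤δᵤ       : 1 ≤ m → 1 ≤ dist C* C₀

      reachable : ∀ {C} (h : History C) → Reachable C (splits h) (merges h)
      reachable start = record
        { isClustering = C₀-cl ; overclustering-≤ = ≤-refl ; underclustering-≤ = ≤-refl ; merged⇒1≤δᵤ = λ () }
      reachable (afterSplit {C} {A} h A∈ A-impure) = record
        { isClustering      = E.isClustering
        ; overclustering-≤  = ≤-trans (≤-reflexive (sym (+-suc (splits h) _))) (≤-trans (+-monoʳ-≤ (splits h) E.overclustering-<) R.overclustering-≤)
        ; underclustering-≤ = ≤-trans E.underclustering-≤ R.underclustering-≤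
        ; merged⇒1≤δᵤ       = R.merged⇒1≤δᵤ
        }
        where
        module R = Reachable (reachable h)
        module E = Split-effect (split-effect R.isClustering A∈ A-impure)
      reachable (afterMerge {C} h i) = record
        { isClustering      = E.isClustering
        ; overclustering-≤  = ≤-trans (+-monoʳ-≤ (splits h) E.overclustering-≤) R.overclustering-≤
        ; underclustering-≤ = ≤-trans E.underclustering-≤ R.underclustering-≤
        ; merged⇒1≤δᵤ       = λ _ → ≤-trans 1≤dist R.underclustering-≤
        }
        where
        module R = Reachable (reachable h)
        module E = Merge-effect (All.lookup (all-merge-effects R.isClustering) (∈-lookup {xs = mergePairs C} i))
        1≤dist : 1 ≤ dist C* C
        1≤dist = n≢0⇒n>0 λ dist≡0 → <⇒≱ (inhabited⇒1≤ i)
          (≤-trans (mergePairs≤ R.isClustering) (≤-reflexive (cong (_* progressPairs C) dist≡0)))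
          where
          inhabited⇒1≤ : ∀ {m} → Fin m → 1 ≤ m
          inhabited⇒1≤ zero    = s≤s z≤n
          inhabited⇒1≤ (suc _) = s≤s z≤n

open Combinatorics

n≤2^n : ∀ n → n ℕ.≤ 2 ℕ.^ n
n≤2^n zero    = z≤n
n≤2^n (suc n) = ℕ.≤-trans (ℕ.+-mono-≤ (ℕ.m^n>0 2 n) (n≤2^n n))
  (ℕ.+-monoʳ-≤ (2 ℕ.^ n) (ℕ.≤-reflexive (≡.sym (ℕ.+-identityʳ _))))

≢[]⇒1≤length : ∀ {a} {A : Set a} (xs : List A) → xs ≢ [] → 1 ℕ.≤ length xs
≢[]⇒1≤length []      ≢[] = ⊥-elim (≢[] refl)
≢[]⇒1≤length (_ ∷ _) _   = s≤s z≤n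

sum-allFin-lookup : ∀ {a} {A : Set a} (f : A → ℕ) xs →
                    sum (map (λ i → f (lookup xs i)) (allFin (length xs))) ≡ sum (map f xs)
sum-allFin-lookup f xs = ≡.cong sum (≡.trans (map-∘ (allFin (length xs)))
  (≡.cong (map f) (≡.trans (map-tabulate id (lookup xs)) (tabulate-lookup xs))))

-- Probabilities under finite distributions

module ProbabilityProperties {a ℓ₁ ℓ₂} (K : ArchimedeanOrderedField a ℓ₁ ℓ₂) where
  open OrderedField K
  open Probability K

  Σ-fromℕ : ∀ {b} {A : Set b} (f : A → ℕ) xs → Σ[ map (fromℕ ∘ f) xs ] ≈ fromℕ (sum (map f xs))
  Σ-fromℕ f []       = ≈-refl
  Σ-fromℕ f (x ∷ xs) = ≈-trans (+-congˡ (Σ-fromℕ f xs)) (≈-sym (fromℕ-homo-+ (f x) _))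

  Σ-1 : ∀ {b} {A : Set b} (xs : List A) → Σ[ map (λ _ → 1#) xs ] ≈ fromℕ (length xs)
  Σ-1 []       = ≈-refl
  Σ-1 (_ ∷ xs) = +-congˡ (Σ-1 xs)

  module _ {b p} {A : Set b} {P : Pred A p} (P? : Decidable P) where
    Pr-return-yes : ∀ {x} → P x → Pr P? (return x) ≈ 1#
    Pr-return-yes {x} Px with P? x
    ... | yes _  = +-identityʳ 1#
    ... | no ¬Px = ⊥-elim (¬Px Px)

    0≤Pr-return : ∀ x → 0# ≤ Pr P? (return x)
    0≤Pr-return x with P? x
    ... | yes _ = ≤-trans 0≤1 (≤-reflexive (≈-sym (+-identityʳ 1#)))
    ... | no _  = ≤-refl

    Pr-++ : ∀ d e → Pr P? (d ++ e) ≈ Pr P? d + Pr P? e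
    Pr-++ []            e = ≈-sym (+-identityˡ _)
    Pr-++ ((x , q) ∷ d) e with P? x
    ... | yes _ = ≈-trans (+-congˡ (Pr-++ d e)) (≈-sym (+-assoc q _ _))
    ... | no _  = Pr-++ d e

    Pr-scale : ∀ q d → Pr P? (map (map₂ (q *_)) d) ≈ q * Pr P? d
    Pr-scale q []            = ≈-sym (zeroʳ q)
    Pr-scale q ((x , w) ∷ d) with P? x
    ... | yes _ = ≈-trans (+-congˡ (Pr-scale q d)) (≈-sym (distribˡ q w _))
    ... | no _  = Pr-scale q d

    Pr->>= : ∀ {c} {B : Set c} (d : FinDist B) (f : B → FinDist A) →
             Pr P? (d >>= f) ≈ Σ[ map (λ (x , q) → q * Pr P? (f x)) d ]
    Pr->>= []            f = ≈-refl
    Pr->>= ((x , q) ∷ d) f = ≈-trans (Pr-++ (map (map₂ (q *_)) (f x)) (d >>= f)) (+-cong (Pr-scale q (f x)) (Pr->>= d f))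

    Pr-uniform : ∀ m (f : Fin m → FinDist A) →
                 Pr P? (uniform m >>= f) ≈ fromℕ m ⁻¹ * Σ[ map (λ i → Pr P? (f i)) (allFin m) ]
    Pr-uniform m f = ≈-trans (Pr->>= (uniform m) f)
      (≈-trans (≈-reflexive (≡.cong Σ[_] (≡.sym (map-∘ (allFin m)))))
               (Σ-distribˡ-* (fromℕ m ⁻¹) (λ i → Pr P? (f i)) (allFin m)))

-- The growth rate of the supermartingale

module GrowthRate {a ℓ₁ ℓ₂} (K : ArchimedeanOrderedField a ℓ₁ ℓ₂) (v : ℕ) where
  open OrderedField K

  rate : Carrier
  rate = fromℕ (2 ℕ.+ v) / fromℕ (suc v)

  0<1+v : 0# < fromℕ (suc v)
  0<1+v = 0<fromℕ {suc v} (s≤s z≤n)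

  1≤rate : 1# ≤ rate
  1≤rate = *-cancelʳ-≤ 0<1+v (begin
    1# * fromℕ (suc v)      ≈⟨ *-identityˡ _ ⟩
    fromℕ (suc v)           ≤⟨ fromℕ-mono-≤ (ℕ.n≤1+n (suc v)) ⟩
    fromℕ (2 ℕ.+ v)         ≈⟨ x/y*y≈x _ 0<1+v ⟨
    rate * fromℕ (suc v)    ∎)

  0≤rate : 0# ≤ rate
  0≤rate = ≤-trans 0≤1 1≤rate

  -- Bernoulli's inequality `1 + m / (1 + v) ≤ (1 + 1 / (1 + v)) ^ m`, multiplied by `1 + v`.
  bernoulli : ∀ m → fromℕ (suc v ℕ.+ m) ≤ rate ^ m * fromℕ (suc v)
  bernoulli zero    = ≤-reflexive (≈-trans (≈-reflexive (≡.cong fromℕ (ℕ.+-identityʳ (suc v)))) (≈-sym (*-identityˡ _)))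
  bernoulli (suc m) = begin
    fromℕ (suc v ℕ.+ suc m)                        ≈⟨ ≈-reflexive (≡.cong fromℕ (ℕ.+-suc (suc v) m)) ⟩
    fromℕ (2 ℕ.+ v ℕ.+ m)                          ≈⟨ fromℕ-homo-+ (2 ℕ.+ v) m ⟩
    fromℕ (2 ℕ.+ v) + fromℕ m                      ≤⟨ +-mono-≤ (≤-reflexive (≈-sym (x/y*y≈x _ 0<1+v)))
                                                        (≤-trans (≤-reflexive (≈-sym (*-identityˡ _))) (*-monoʳ-≤ (0≤fromℕ m) 1≤rate)) ⟩
    rate * fromℕ (suc v) + rate * fromℕ m          ≈⟨ distribˡ rate _ _ ⟨
    rate * (fromℕ (suc v) + fromℕ m)               ≈⟨ *-congˡ (fromℕ-homo-+ (suc v) m) ⟨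
    rate * fromℕ (suc v ℕ.+ m)                     ≤⟨ *-monoˡ-≤ 0≤rate (bernoulli m) ⟩
    rate * (rate ^ m * fromℕ (suc v))              ≈⟨ *-assoc rate _ _ ⟨
    rate ^ suc m * fromℕ (suc v)                   ∎

  -- Every `2 + v` merges at least double the supermartingale's factor; this exchanges powers of
  -- `rate` for the powers of 2 in which the logarithmic bound is expressed.
  2≤rate^ : fromℕ 2 ≤ rate ^ (2 ℕ.+ v)
  2≤rate^ = *-cancelʳ-≤ 0<1+v (begin
    fromℕ 2 * fromℕ (suc v)               ≈⟨ fromℕ-homo-* 2 (suc v) ⟨
    fromℕ (2 ℕ.* suc v)                   ≤⟨ fromℕ-mono-≤ (ℕ.+-monoʳ-≤ (suc v) (ℕ.≤-trans (ℕ.≤-reflexive (ℕ.+-identityʳ _)) (ℕ.n≤1+n (suc v)))) ⟩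
    fromℕ (suc v ℕ.+ (2 ℕ.+ v))           ≤⟨ bernoulli (2 ℕ.+ v) ⟩
    rate ^ (2 ℕ.+ v) * fromℕ (suc v)      ∎)

  2^m≤[rate^m]^[2+v] : ∀ m → fromℕ 2 ^ m ≤ (rate ^ m) ^ (2 ℕ.+ v)
  2^m≤[rate^m]^[2+v] m = begin
    fromℕ 2 ^ m                   ≤⟨ ^-mono-≤ m (0≤fromℕ 2) 2≤rate^ ⟩
    (rate ^ (2 ℕ.+ v)) ^ m        ≈⟨ ^-assocʳ rate (2 ℕ.+ v) m ⟩
    rate ^ ((2 ℕ.+ v) ℕ.* m)      ≈⟨ ≈-reflexive (≡.cong (rate ^_) (ℕ.*-comm (2 ℕ.+ v) m)) ⟩
    rate ^ (m ℕ.* (2 ℕ.+ v))      ≈⟨ ^-assocʳ rate m (2 ℕ.+ v) ⟨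
    (rate ^ m) ^ (2 ℕ.+ v)        ∎

-- The supermartingale and the bound on the probability of failure

module Analysis {a ℓ₁ ℓ₂} (K : ArchimedeanOrderedField a ℓ₁ ℓ₂) {n : ℕ} {T : Tree n} {C* C₀ : Clustering n}
                (C*-cl : IsClustering C*) (C₀-cl : IsClustering C₀) (T-lam : Laminar C* T) (T-all : ∀ x → x ∈ ⟦ T ⟧) where
  open OrderedField K
  open Similarity K
  open Probability K
  open ProbabilityProperties K
  open Interaction T C* C₀
  open Dynamics {C₀ = C₀} C*-cl T-lam T-all

  δₒ δᵤ k Φ₀ bound : ℕ
  δₒ    = dist C₀ C*
  δᵤ    = dist C* C₀
  k     = length C*
  Φ₀    = potential C₀
  bound = 20 ℕ.* (δᵤ ℕ.* δᵤ)

  open GrowthRate K (2 ℕ.* δᵤ)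

  1≤k : 1 ℕ.≤ k
  1≤k = ∈-length (proj₁ (proj₂ (clusterOf C*-cl (proj₁ (tree-nonempty T)))))

  -- The origin of 20: for `δᵤ ≥ 1`, `suc Φ₀` is at most `5 δᵤ` and `2 + 2 δᵤ` is at most `4 δᵤ`.
  bound≥ : 1 ℕ.≤ δᵤ → suc Φ₀ ℕ.* (2 ℕ.+ 2 ℕ.* δᵤ) ℕ.≤ bound
  bound≥ 1≤δᵤ = ℕ.≤-trans
    (ℕ.*-mono-≤ (ℕ.+-mono-≤ 1≤δᵤ (potential≤4δ C₀)) (ℕ.+-monoˡ-≤ (2 ℕ.* δᵤ) (ℕ.*-monoʳ-≤ 2 1≤δᵤ)))
    (ℕ.≤-reflexive (regroup δᵤ))
    where
    regroup : ∀ δ → (δ ℕ.+ 4 ℕ.* δ) ℕ.* (2 ℕ.* δ ℕ.+ 2 ℕ.* δ) ≡ 20 ℕ.* (δ ℕ.* δ)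
    regroup = solve-∀

  module _ (ε : Carrier) (0<ε : 0# < ε) (ε<1 : ε < 1#) where
    x Q z : Carrier
    x = fromℕ k / ε
    Q = fromℕ (2 ℕ.^ Φ₀)
    z = ε ⁻¹

    0<Q : 0# < Q
    0<Q = 0<fromℕ (ℕ.m^n>0 2 Φ₀)

    1≤z : 1# ≤ z
    1≤z = begin
      1#       ≈⟨ *-inverseˡ 0<ε ⟨
      z * ε    ≤⟨ *-monoˡ-≤ (0≤x⁻¹ 0<ε) (proj₁ ε<1) ⟩
      z * 1#   ≈⟨ *-identityʳ z ⟩
      z        ∎

    0≤z : 0# ≤ z
    0≤z = ≤-trans 0≤1 1≤z

    z≤x : z ≤ x
    z≤x = begin
      z           ≈⟨ *-identityˡ z ⟨
      1# * z      ≤⟨ *-monoʳ-≤ 0≤z (1≤fromℕ 1≤k) ⟩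
      x           ∎

    1≤2 : 1# ≤ fromℕ 2
    1≤2 = 1≤fromℕ {2} (s≤s z≤n)

    -- The division by `Q`, which is `2 ^ Φ₀`, makes the supermartingale start at `ε`, so that it
    -- bounds the failure probability directly.
    scale : ℕ → Carrier
    scale m = rate ^ m * (ε / Q)

    0≤scale : ∀ m → 0# ≤ scale m
    0≤scale m = *-nonNeg (0≤^ m 0≤rate) (*-nonNeg (proj₁ 0<ε) (0≤x⁻¹ 0<Q))

    scale-mono : ∀ {m m′} → m ℕ.≤ m′ → scale m ≤ scale m′
    scale-mono m≤m′ = *-monoʳ-≤ (*-nonNeg (proj₁ 0<ε) (0≤x⁻¹ 0<Q)) (^-monoʳ-≤ 1≤rate m≤m′)

    1≤scale : ∀ {m} → Q * z ≤ rate ^ m → 1# ≤ scale m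
    1≤scale {m} le = begin
      1#                        ≈⟨ *-inverseʳ Q (<⇒≉0 0<Q) ⟨
      Q * Q ⁻¹                  ≈⟨ *-congʳ (≈-trans (*-congˡ (*-inverseˡ 0<ε)) (*-identityʳ Q)) ⟨
      Q * (z * ε) * Q ⁻¹        ≈⟨ *-congʳ (*-assoc Q z ε) ⟨
      Q * z * ε * Q ⁻¹          ≈⟨ *-assoc (Q * z) ε _ ⟩
      Q * z * (ε / Q)           ≤⟨ *-monoʳ-≤ (*-nonNeg (proj₁ 0<ε) (0≤x⁻¹ 0<Q)) le ⟩
      scale m                   ∎

    -- It is enough that `Q * z ≤ rate ^ m`. Both sides are raised to the power `2 + 2 δᵤ`, after
    -- which the right one is at least `2 ^ m`, and being late bounds `2 ^ m` from below. No
    -- logarithm is taken; the common exponent is cancelled at the end.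
    late⇒1≤scale : ∀ {m} → (1 ℕ.≤ m → 1 ℕ.≤ δᵤ) → ¬ (m ≤ bound ·log₂ x) → 1# ≤ scale m
    late⇒1≤scale {m} 1≤m⇒1≤δᵤ late = 1≤scale {m}
      (^-cancel-≤ (suc (2 ℕ.* δᵤ)) (*-nonNeg (proj₁ 0<Q) 0≤z) (0≤^ m 0≤rate) (≤-trans power (2^m≤[rate^m]^[2+v] m)))
      where
      bound<m : bound ℕ.< m
      bound<m = ℕ.≰⇒> (late ∘ inj₁)

      -- `y` plays the maximum of 2 and `z`. It dominates the `Φ₀` factors 2 of `Q` and the single
      -- factor `z`, whence the exponent `suc Φ₀`.
      power-≤ : ∀ y → fromℕ 2 ≤ y → z ≤ y → y ^ bound ≤ fromℕ 2 ^ m → (Q * z) ^ (2 ℕ.+ 2 ℕ.* δᵤ) ≤ fromℕ 2 ^ m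
      power-≤ y 2≤y z≤y le = begin
        (Q * z) ^ (2 ℕ.+ 2 ℕ.* δᵤ)               ≤⟨ ^-mono-≤ (2 ℕ.+ 2 ℕ.* δᵤ) (*-nonNeg (proj₁ 0<Q) 0≤z) Qz≤ ⟩
        (y ^ suc Φ₀) ^ (2 ℕ.+ 2 ℕ.* δᵤ)          ≈⟨ ^-assocʳ y (suc Φ₀) (2 ℕ.+ 2 ℕ.* δᵤ) ⟩
        y ^ (suc Φ₀ ℕ.* (2 ℕ.+ 2 ℕ.* δᵤ))        ≤⟨ ^-monoʳ-≤ 1≤y (bound≥ (1≤m⇒1≤δᵤ (ℕ.≤-trans (s≤s z≤n) bound<m))) ⟩
        y ^ bound                                ≤⟨ le ⟩
        fromℕ 2 ^ m                              ∎
        where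
        1≤y = ≤-trans 1≤2 2≤y
        0≤y = ≤-trans 0≤1 1≤y
        Qz≤ : Q * z ≤ y ^ suc Φ₀
        Qz≤ = begin
          Q * z               ≈⟨ *-congʳ (fromℕ-^ 2 Φ₀) ⟩
          fromℕ 2 ^ Φ₀ * z    ≤⟨ *-mono-≤ (0≤^ Φ₀ (0≤fromℕ 2)) 0≤y (^-mono-≤ Φ₀ (0≤fromℕ 2) 2≤y) z≤y ⟩
          y ^ Φ₀ * y          ≈⟨ *-comm _ y ⟩
          y ^ suc Φ₀          ∎

      power : (Q * z) ^ (2 ℕ.+ 2 ℕ.* δᵤ) ≤ fromℕ 2 ^ m
      -- For `z ≤ 2` the first half of the negated bound is enough, with base 2. Otherwise the
      -- second half, which is about `x ^ bound`, applies because `z ≤ x`.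
      power with total z (fromℕ 2)
      ... | inj₁ z≤2 = power-≤ (fromℕ 2) ≤-refl z≤2 (^-monoʳ-≤ 1≤2 (ℕ.<⇒≤ bound<m))
      ... | inj₂ 2≤z = power-≤ z 2≤z ≤-refl (≤-trans (^-mono-≤ bound 0≤z z≤x) (≰⇒≥ (late ∘ inj₂)))

    -- Needed for runs cut off before reaching the target, to which the logarithmic bound does not
    -- apply. The witness comes from `z ≤ j ≤ 2 ^ j` and one doubling per `2 + 2 δᵤ` merges.
    eventually-1≤scale : ∃[ m ] 1# ≤ scale m
    eventually-1≤scale with j , z≤j ← archimedean z = (2 ℕ.+ 2 ℕ.* δᵤ) ℕ.* (Φ₀ ℕ.+ j) , 1≤scale {(2 ℕ.+ 2 ℕ.* δᵤ) ℕ.* (Φ₀ ℕ.+ j)} (begin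
      Q * z                                        ≤⟨ *-monoˡ-≤ (proj₁ 0<Q) (≤-trans z≤j (fromℕ-mono-≤ (n≤2^n j))) ⟩
      Q * fromℕ (2 ℕ.^ j)                          ≈⟨ *-cong (fromℕ-^ 2 Φ₀) (fromℕ-^ 2 j) ⟩
      fromℕ 2 ^ Φ₀ * fromℕ 2 ^ j                   ≈⟨ ^-homo-* (fromℕ 2) Φ₀ j ⟨
      fromℕ 2 ^ (Φ₀ ℕ.+ j)                         ≤⟨ ^-mono-≤ (Φ₀ ℕ.+ j) (0≤fromℕ 2) 2≤rate^ ⟩
      (rate ^ (2 ℕ.+ 2 ℕ.* δᵤ)) ^ (Φ₀ ℕ.+ j)       ≈⟨ ^-assocʳ rate (2 ℕ.+ 2 ℕ.* δᵤ) (Φ₀ ℕ.+ j) ⟩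
      rate ^ ((2 ℕ.+ 2 ℕ.* δᵤ) ℕ.* (Φ₀ ℕ.+ j))     ∎)

    -- A supermartingale along the process: it bounds the probability of failure.
    loss : Clustering n → ℕ → Carrier
    loss C m = fromℕ (2 ℕ.^ potential C) * scale m

    scale≤loss : ∀ C m → scale m ≤ loss C m
    scale≤loss C m = ≤-trans (≤-reflexive (≈-sym (*-identityˡ _)))
      (*-monoʳ-≤ (0≤scale m) (1≤fromℕ (ℕ.m^n>0 2 (potential C))))

    loss-mono : ∀ {C C′} m → potential C′ ℕ.≤ potential C → loss C′ m ≤ loss C m
    loss-mono m le = *-monoʳ-≤ (0≤scale m) (fromℕ-mono-≤ (ℕ.^-monoʳ-≤ 2 le))

    loss-initial : loss C₀ 0 ≈ ε
    loss-initial = ≈-trans (*-congˡ (*-identityˡ _)) (≈-trans (*-comm Q _) (x/y*y≈x ε 0<Q))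

    -- The supermartingale step, as a sum over the pairs instead of a mean: the factor `rate` gained
    -- by one more merge is offset by the decrease of the mean of `2 ^ potential`.
    loss-merge : ∀ {C} (C-cl : IsClustering C) → dist C* C ℕ.≤ δᵤ → ∀ m →
      Σ[ map (λ i → loss (mergeClusters (lookup (mergePairs C) i) C) (suc m)) (allFin (length (mergePairs C))) ]
      ≤ loss C m * fromℕ (length (mergePairs C))
    loss-merge {C} C-cl dist≤ m = begin
      Σ[ map (λ i → fromℕ (g i) * scale (suc m)) (allFin M) ]   ≈⟨ Σ-cong (allFin M) (λ i → *-comm _ _) ⟩
      Σ[ map (λ i → scale (suc m) * fromℕ (g i)) (allFin M) ]   ≈⟨ Σ-distribˡ-* (scale (suc m)) (fromℕ ∘ g) (allFin M) ⟩
      scale (suc m) * Σ[ map (fromℕ ∘ g) (allFin M) ]           ≈⟨ *-congˡ (Σ-fromℕ g (allFin M)) ⟩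
      scale (suc m) * fromℕ (sum (map g (allFin M)))            ≈⟨ *-congˡ (≈-reflexive (≡.cong fromℕ (sum-allFin-lookup _ (mergePairs C)))) ⟩
      scale (suc m) * fromℕ G                                   ≈⟨ *-congʳ (*-assoc rate _ _) ⟩
      rate * scale m * fromℕ G                                  ≈⟨ *-congʳ (*-comm rate _) ⟩
      scale m * rate * fromℕ G                                  ≈⟨ *-assoc (scale m) rate _ ⟩
      scale m * (rate * fromℕ G)                                ≤⟨ *-monoˡ-≤ (0≤scale m) rate*G≤ ⟩
      scale m * fromℕ (M ℕ.* F)                                 ≈⟨ *-congˡ (≈-trans (fromℕ-homo-* M F) (*-comm _ _)) ⟩
      scale m * (fromℕ F * fromℕ M)                             ≈⟨ *-assoc (scale m) _ _ ⟨
      scale m * fromℕ F * fromℕ M                               ≈⟨ *-congʳ (*-comm (scale m) _) ⟩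
      loss C m * fromℕ M                                        ∎
      where
      M = length (mergePairs C)
      F = 2 ℕ.^ potential C
      G = sum (map (λ pr → 2 ℕ.^ potential (mergeClusters pr C)) (mergePairs C))
      g : Fin M → ℕ
      g i = 2 ℕ.^ potential (mergeClusters (lookup (mergePairs C) i) C)
      rate*G≤ : rate * fromℕ G ≤ fromℕ (M ℕ.* F)
      rate*G≤ = *-cancelʳ-≤ 0<1+v (begin
        rate * fromℕ G * fromℕ (1 ℕ.+ 2 ℕ.* δᵤ)       ≈⟨ *-congʳ (*-comm rate _) ⟩
        fromℕ G * rate * fromℕ (1 ℕ.+ 2 ℕ.* δᵤ)       ≈⟨ *-assoc (fromℕ G) rate _ ⟩
        fromℕ G * (rate * fromℕ (1 ℕ.+ 2 ℕ.* δᵤ))     ≈⟨ *-congˡ (x/y*y≈x _ 0<1+v) ⟩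
        fromℕ G * fromℕ (2 ℕ.+ 2 ℕ.* δᵤ)              ≈⟨ *-comm _ _ ⟩
        fromℕ (2 ℕ.+ 2 ℕ.* δᵤ) * fromℕ G              ≈⟨ fromℕ-homo-* (2 ℕ.+ 2 ℕ.* δᵤ) G ⟨
        fromℕ ((2 ℕ.+ 2 ℕ.* δᵤ) ℕ.* G)                ≤⟨ fromℕ-mono-≤ (sum-potential C-cl δᵤ dist≤) ⟩
        fromℕ ((1 ℕ.+ 2 ℕ.* δᵤ) ℕ.* (M ℕ.* F))        ≈⟨ fromℕ-homo-* (1 ℕ.+ 2 ℕ.* δᵤ) (M ℕ.* F) ⟩
        fromℕ (1 ℕ.+ 2 ℕ.* δᵤ) * fromℕ (M ℕ.* F)      ≈⟨ *-comm _ _ ⟩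
        fromℕ (M ℕ.* F) * fromℕ (1 ℕ.+ 2 ℕ.* δᵤ)      ∎)

    found? = foundWithin? K δₒ bound x

    module _ (O : Oracle) where
      m₁ = proj₁ eventually-1≤scale

      1-y≤w : ∀ {y w} → 1# ≤ y → 0# ≤ w → 1# - y ≤ w
      1-y≤w {y} {w} 1≤y 0≤w = x+y≥z⇒x≥z-y (begin
        1#        ≤⟨ 1≤y ⟩
        y         ≈⟨ +-identityˡ y ⟨
        0# + y    ≤⟨ +-monoˡ-≤ y 0≤w ⟩
        w + y     ∎)

      1-y≤1 : ∀ {y} → 0# ≤ y → 1# - y ≤ 1#
      1-y≤1 {y} 0≤y = x+y≥z⇒x≥z-y (≤-trans (≤-reflexive (≈-sym (+-identityʳ 1#))) (+-monoʳ-≤ 1# 0≤y))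

      1-mono : ∀ {y y′} → y ≤ y′ → 1# - y′ ≤ 1# - y
      1-mono {y} {y′} le = x+y≥z⇒x≥z-y (≤-trans (x≥z-y⇒x+y≥z ≤-refl) (+-monoʳ-≤ _ le))

      -- Optional stopping by induction on the remaining requests: a split does not raise the loss,
      -- and a merge does not raise its mean. A run that stops in failure, too late or unfinished,
      -- has loss at least 1, so nothing is claimed about it. `enough` covers the unfinished runs:
      -- at most `δₒ` requests were splits, so at least `m₁` were merges.
      success : ∀ N {C} (h : History C) → δₒ ℕ.+ m₁ ℕ.≤ N ℕ.+ (splits h ℕ.+ merges h) →
                1# - loss C (merges h) ≤ Pr found? (continue K O N h)
      success N {C} h enough with C ≋? C*
      ... | yes C≋C* with merges h ≤? bound ·log₂ x
      ...   | yes in-time = ≤-trans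
        (1-y≤1 (≤-trans (0≤scale (merges h)) (scale≤loss C (merges h))))
        (≤-reflexive (≈-sym (Pr-return-yes found? (C≋C* , ℕ.≤-trans (ℕ.m≤m+n _ _) overclustering-≤ , in-time))))
        where open Reachable (reachable C₀-cl h)
      ...   | no late = 1-y≤w (≤-trans (late⇒1≤scale merged⇒1≤δᵤ late) (scale≤loss C (merges h))) (0≤Pr-return found? (C , h))
        where open Reachable (reachable C₀-cl h)
      success zero {C} h enough | no _ = 1-y≤w
        (≤-trans (proj₂ eventually-1≤scale) (≤-trans (scale-mono m₁≤) (scale≤loss C (merges h)))) (0≤Pr-return found? (C , h))
        where
        open Reachable (reachable C₀-cl h)
        m₁≤ : m₁ ℕ.≤ merges h
        m₁≤ = ℕ.+-cancelˡ-≤ δₒ _ _ (ℕ.≤-trans enough (ℕ.+-monoˡ-≤ (merges h) (ℕ.≤-trans (ℕ.m≤m+n _ _) overclustering-≤)))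
      success (suc N) {C} h enough | no C≉C* with O h C≉C*
      ... | split A∈C A-impure = ≤-trans
        (1-mono (loss-mono {C} {splitCluster _ C} (merges h) (Split-effect.potential-≤ (split-effect isClustering A∈C A-impure))))
        (success N (afterSplit h A∈C A-impure) (ℕ.≤-trans enough (ℕ.≤-reflexive (≡.sym (ℕ.+-suc N _)))))
        where open Reachable (reachable C₀-cl h)
      ... | merge pairs≢[] = *-cancelʳ-≤ 0<M (begin
        (1# - loss C m) * fromℕ M                                         ≤⟨ mean≥ ⟩
        Σ[ map V (allFin M) ]                                             ≈⟨ *-identityˡ _ ⟨
        1# * Σ[ map V (allFin M) ]                                        ≈⟨ *-congʳ (*-inverseʳ (fromℕ M) (<⇒≉0 0<M)) ⟨
        fromℕ M * fromℕ M ⁻¹ * Σ[ map V (allFin M) ]                      ≈⟨ *-assoc _ _ _ ⟩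
        fromℕ M * (fromℕ M ⁻¹ * Σ[ map V (allFin M) ])                    ≈⟨ *-congˡ (Pr-uniform found? M (λ i → continue K O N (afterMerge h i))) ⟨
        fromℕ M * Pr found? (uniform M >>= λ i → continue K O N (afterMerge h i)) ≈⟨ *-comm _ _ ⟩
        Pr found? (uniform M >>= λ i → continue K O N (afterMerge h i)) * fromℕ M ∎)
        where
        open Reachable (reachable C₀-cl h)
        m = merges h
        M = length (mergePairs C)
        V L : Fin M → Carrier
        V i = Pr found? (continue K O N (afterMerge h i))
        L i = loss (mergeClusters (lookup (mergePairs C) i) C) (suc m)
        0<M : 0# < fromℕ M
        0<M = 0<fromℕ (≢[]⇒1≤length (mergePairs C) pairs≢[])
        enough′ : δₒ ℕ.+ m₁ ℕ.≤ N ℕ.+ (splits h ℕ.+ suc m)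
        enough′ = ℕ.≤-trans enough (ℕ.≤-reflexive
          (≡.trans (≡.sym (ℕ.+-suc N _)) (≡.cong (N ℕ.+_) (≡.sym (ℕ.+-suc (splits h) m)))))
        M≤ : fromℕ M ≤ Σ[ map V (allFin M) ] + loss C m * fromℕ M
        M≤ = begin
          fromℕ M                                             ≈⟨ ≈-reflexive (≡.cong fromℕ (length-tabulate {n = M} id)) ⟨
          fromℕ (length (allFin M))                           ≈⟨ Σ-1 (allFin M) ⟨
          Σ[ map (λ _ → 1#) (allFin M) ]                      ≤⟨ Σ-mono-≤ _ _ (allFin M) (λ i → x≥z-y⇒x+y≥z (success N (afterMerge h i) enough′)) ⟩
          Σ[ map (λ i → V i + L i) (allFin M) ]               ≈⟨ Σ-distrib-+ V L (allFin M) ⟩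
          Σ[ map V (allFin M) ] + Σ[ map L (allFin M) ]       ≤⟨ +-monoʳ-≤ _ (loss-merge isClustering underclustering-≤ m) ⟩
          Σ[ map V (allFin M) ] + loss C m * fromℕ M          ∎
        mean≥ : (1# - loss C m) * fromℕ M ≤ Σ[ map V (allFin M) ]
        mean≥ = +-cancelʳ-≤ (loss C m * fromℕ M) (begin
          (1# - loss C m) * fromℕ M + loss C m * fromℕ M      ≈⟨ distribʳ (fromℕ M) _ _ ⟨
          (1# - loss C m + loss C m) * fromℕ M                ≈⟨ *-congʳ (x-z+z≈x 1# (loss C m)) ⟩
          1# * fromℕ M                                        ≈⟨ *-identityˡ _ ⟩
          fromℕ M                                             ≤⟨ M≤ ⟩
          Σ[ map V (allFin M) ] + loss C m * fromℕ M          ∎)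

      success-run : 1# - ε ≤ Pr found? (run K O (δₒ ℕ.+ m₁))
      success-run = ≤-trans (1-mono (≤-reflexive loss-initial)) (success (δₒ ℕ.+ m₁) start (ℕ.≤-reflexive (≡.sym (ℕ.+-identityʳ _))))

theorem20 : ∀ {a ℓ₁ ℓ₂} →
    ∃[ c ] ∀ (K : ArchimedeanOrderedField a ℓ₁ ℓ₂) {n : ℕ} →
    let open ArchimedeanOrderedField K
        open Similarity K
        open Probability K
    in
    (S : SimilarityFunction n) → Symmetric S →
    (C* C₀ : Clustering n) → IsClustering C* → IsClustering C₀ →
    Stable S C* →
    (T : Tree n) → IsAverageLinkageTree S T →
    let open Interaction T C* C₀
        k  = length C*
        δₒ = dist C₀ C*
        δᵤ = dist C* C₀
    in
    (O : Oracle) →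
    ∀ ε → 0# < ε → ε < 1# →
    ∃[ N ] 1# - ε ≤ Pr (foundWithin? K δₒ (c *ℕ (δᵤ *ℕ δᵤ)) (fromℕ k / ε)) (run K O N)
theorem20 = 20 , λ K S S-sym C* C₀ C*-cl C₀-cl stable T linkage O ε 0<ε ε<1 →
  let T-lam , T-all = AverageLinkage.averageLinkage-laminar K S C*-cl stable S-sym linkage in
  _ , Analysis.success-run K C*-cl C₀-cl T-lam T-all ε 0<ε ε<1 O
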